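{- For every simple graph $G$ on $n$ vertices, with complement $\overline{G}$, \[\lambda_1(G)+\lambda_1(\overline{G})\le \frac43 n-1.\]
   Context: Graphs here are finite, simple and undirected (no loops), and $\overline{G}$ is the usual complement. $\lambda_1(G)$ denotes the largest eigenvalue of the adjacency matrix of $G$. -}

module Defs where

open import Algebra.Bundles using (CommutativeMonoid)
open import Algebra.Bundles.Raw using (RawMonoid)
import Algebra.Definitions.RawMonoid as RawMonoidDefinitions
open import Data.Bool.Base using (if_then_else_)
open import Data.Fin.Base using (Fin)
open import Data.Fin.Properties using (_≟_)
open import Data.Nat.Base as ℕ using (ℕ)
import Data.Nat.Properties as ℕ
open import Data.Product.Base using (∃-syntax; Σ-syntax; _×_; _,_; proj₁; proj₂)
open import Data.Rational.Base
open import Data.Rational.Properties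
  hiding (_≟_)
open import Data.Vec.Functional using (Vector)
open import Function.Base using (_∘_)
open import Level using (0ℓ)
open import Relation.Binary.Core using (Rel)
open import Relation.Binary.Definitions using (Symmetric; Irreflexive; Decidable)
open import Relation.Binary.PropositionalEquality
  using (_≡_; _≢_; sym; trans; cong; cong₂; subst)
open import Relation.Nullary.Decidable.Core using (does; ¬?; _×-dec_)
open import Relation.Nullary.Negation.Core using (¬_)

IsCauchy : (ℕ → ℚ) → Set
IsCauchy x = ∀ ε → 0ℚ < ε →
  ∃[ N ] (∀ m n → N ℕ.≤ m → N ℕ.≤ n → ∣ x m - x n ∣ < ε)

-- To be compared with _≃ᴿ_, not with _≡_.
record ℝ : Set where
  constructor mkℝ
  field
    seq    : ℕ → ℚ
    cauchy : IsCauchy seq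

open ℝ public

infix 4 _≃ᴿ_ _≤ᴿ_

_≃ᴿ_ : Rel ℝ 0ℓ
x ≃ᴿ y = ∀ ε → 0ℚ < ε →
  ∃[ N ] (∀ n → N ℕ.≤ n → ∣ seq x n - seq y n ∣ < ε)

-- The slack ε is needed: representatives of equal reals need not be
-- eventually comparable term by term.
_≤ᴿ_ : Rel ℝ 0ℓ
x ≤ᴿ y = ∀ ε → 0ℚ < ε →
  ∃[ N ] (∀ n → N ℕ.≤ n → seq x n < seq y n + ε)

private

  open import Algebra.Properties.CommutativeSemigroup
    (CommutativeMonoid.commutativeSemigroup +-0-commutativeMonoid)
    using (interchange)
  open import Algebra.Properties.Group +-0-group using (//-rightDividesˡ)
  open import Algebra.Properties.Ring +-*-ring
    using (x[y-z]≈xy-xz; [y-z]x≈yx-zx)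

  half-pos : ∀ {ε} → 0ℚ < ε → 0ℚ < ½ * ε
  half-pos {ε} 0<ε = subst (_< ½ * ε) (*-zeroʳ ½) (*-monoʳ-<-pos ½ 0<ε)

  half+half : ∀ ε → ½ * ε + ½ * ε ≡ ε
  half+half ε = trans (sym (*-distribʳ-+ ε ½ ½)) (*-identityˡ ε)

  const-cauchy : ∀ p → IsCauchy (λ _ → p)
  const-cauchy p ε 0<ε =
    0 , λ _ _ _ _ → subst (_< ε) (sym (cong ∣_∣ (+-inverseʳ p))) 0<ε

  +-cauchy : ∀ {x y} → IsCauchy x → IsCauchy y → IsCauchy (λ n → x n + y n)
  +-cauchy {x} {y} cx cy ε 0<ε = M ℕ.⊔ N , bound
    where
    M = proj₁ (cx (½ * ε) (half-pos 0<ε))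
    N = proj₁ (cy (½ * ε) (half-pos 0<ε))

    rearrange : ∀ a b c d → (a + b) - (c + d) ≡ (a - c) + (b - d)
    rearrange a b c d = trans (cong (a + b +_) (neg-distrib-+ c d))
                              (interchange a b (- c) (- d))

    open ≤-Reasoning

    bound : ∀ m n → M ℕ.⊔ N ℕ.≤ m → M ℕ.⊔ N ℕ.≤ n →
            ∣ (x m + y m) - (x n + y n) ∣ < ε
    bound m n N≤m N≤n = begin-strict
      ∣ (x m + y m) - (x n + y n) ∣   ≡⟨ cong ∣_∣ (rearrange (x m) (y m) (x n) (y n)) ⟩
      ∣ (x m - x n) + (y m - y n) ∣   ≤⟨ ∣p+q∣≤∣p∣+∣q∣ (x m - x n) (y m - y n) ⟩
      ∣ x m - x n ∣ + ∣ y m - y n ∣   <⟨ +-mono-<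
        (proj₂ (cx (½ * ε) (half-pos 0<ε)) m n
          (ℕ.≤-trans (ℕ.m≤m⊔n M N) N≤m) (ℕ.≤-trans (ℕ.m≤m⊔n M N) N≤n))
        (proj₂ (cy (½ * ε) (half-pos 0<ε)) m n
          (ℕ.≤-trans (ℕ.m≤n⊔m M N) N≤m) (ℕ.≤-trans (ℕ.m≤n⊔m M N) N≤n)) ⟩
      ½ * ε + ½ * ε                   ≡⟨ half+half ε ⟩
      ε                               ∎

  eventually-bounded : ∀ {x} → IsCauchy x →
    ∃[ B ] 0ℚ < B × ∃[ N ] (∀ n → N ℕ.≤ n → ∣ x n ∣ ≤ B)
  eventually-bounded {x} cx = 1ℚ + ∣ x N ∣ , 0<B , N , bound
    where
    0<1 : 0ℚ < 1ℚ
    0<1 = positive⁻¹ 1ℚ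

    N = proj₁ (cx 1ℚ 0<1)

    0<B : 0ℚ < 1ℚ + ∣ x N ∣
    0<B = +-mono-<-≤ 0<1 (0≤∣p∣ (x N))

    open ≤-Reasoning

    bound : ∀ n → N ℕ.≤ n → ∣ x n ∣ ≤ 1ℚ + ∣ x N ∣
    bound n N≤n = begin
      ∣ x n ∣                   ≡⟨ cong ∣_∣ (sym (//-rightDividesˡ (x N) (x n))) ⟩
      ∣ (x n - x N) + x N ∣     ≤⟨ ∣p+q∣≤∣p∣+∣q∣ (x n - x N) (x N) ⟩
      ∣ x n - x N ∣ + ∣ x N ∣   ≤⟨ +-monoˡ-≤ ∣ x N ∣
        (<⇒≤ (proj₂ (cx 1ℚ 0<1) n N N≤n ℕ.≤-refl)) ⟩
      1ℚ + ∣ x N ∣              ∎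

  -- A positive δ with B * δ = ε.
  divide : ∀ {B ε} → 0ℚ < B → 0ℚ < ε → ∃[ δ ] 0ℚ < δ × B * δ ≡ ε
  divide {B} {ε} 0<B 0<ε = 1/B * ε , 0<δ , Bδ≡ε
    where
    instance
      B-pos = positive 0<B
      B-nonZero = pos⇒nonZero B
    1/B = 1/ B
    instance
      1/B-pos = 1/pos⇒pos B

    0<δ : 0ℚ < 1/B * ε
    0<δ = subst (_< 1/B * ε) (*-zeroʳ 1/B) (*-monoʳ-<-pos 1/B 0<ε)

    Bδ≡ε : B * (1/B * ε) ≡ ε
    Bδ≡ε = trans (sym (*-assoc B 1/B ε))
             (trans (cong (_* ε) (*-inverseʳ B)) (*-identityˡ ε))

  *-bound : ∀ {a b B δ} → ∣ a ∣ ≤ B → 0ℚ < B → ∣ b ∣ < δ → ∣ a * b ∣ < B * δ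
  *-bound {a} {b} {B} {δ} a≤B 0<B b<δ = begin-strict
    ∣ a * b ∣       ≡⟨ ∣p*q∣≡∣p∣*∣q∣ a b ⟩
    ∣ a ∣ * ∣ b ∣   ≤⟨ *-monoʳ-≤-nonNeg ∣ b ∣ {{∣-∣-nonNeg b}} a≤B ⟩
    B * ∣ b ∣       <⟨ *-monoʳ-<-pos B {{positive 0<B}} b<δ ⟩
    B * δ           ∎
    where open ≤-Reasoning

  *-cauchy : ∀ {x y} → IsCauchy x → IsCauchy y → IsCauchy (λ n → x n * y n)
  *-cauchy {x} {y} cx cy ε 0<ε
    with eventually-bounded cx | eventually-bounded cy
  ... | B , 0<B , K , x≤B | C , 0<C , L , y≤C
    with divide 0<C (half-pos 0<ε) | divide 0<B (half-pos 0<ε)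
  ... | δ , 0<δ , Cδ≡ | η , 0<η , Bη≡
    with cx δ 0<δ | cy η 0<η
  ... | M , x-close | N , y-close = T , bound
    where
    T = (K ℕ.⊔ L) ℕ.⊔ (M ℕ.⊔ N)

    K≤T : K ℕ.≤ T
    K≤T = ℕ.≤-trans (ℕ.m≤m⊔n K L) (ℕ.m≤m⊔n (K ℕ.⊔ L) (M ℕ.⊔ N))
    L≤T : L ℕ.≤ T
    L≤T = ℕ.≤-trans (ℕ.m≤n⊔m K L) (ℕ.m≤m⊔n (K ℕ.⊔ L) (M ℕ.⊔ N))
    M≤T : M ℕ.≤ T
    M≤T = ℕ.≤-trans (ℕ.m≤m⊔n M N) (ℕ.m≤n⊔m (K ℕ.⊔ L) (M ℕ.⊔ N))
    N≤T : N ℕ.≤ T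
    N≤T = ℕ.≤-trans (ℕ.m≤n⊔m M N) (ℕ.m≤n⊔m (K ℕ.⊔ L) (M ℕ.⊔ N))

    open ≤-Reasoning

    rearrange : ∀ a b c d → a * b - c * d ≡ b * (a - c) + c * (b - d)
    rearrange a b c d = sym (begin-equality
      b * (a - c) + c * (b - d)
        ≡⟨ cong₂ _+_ (trans (*-comm b (a - c)) ([y-z]x≈yx-zx b a c))
                     (x[y-z]≈xy-xz c b d) ⟩
      (a * b - c * b) + (c * b - c * d)
        ≡⟨ +-assoc (a * b - c * b) (c * b) (- (c * d)) ⟨
      (a * b - c * b) + c * b - c * d
        ≡⟨ cong (_- c * d) (//-rightDividesˡ (c * b) (a * b)) ⟩
      a * b - c * d ∎)

    bound : ∀ m n → T ℕ.≤ m → T ℕ.≤ n → ∣ x m * y m - x n * y n ∣ < ε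
    bound m n T≤m T≤n = begin-strict
      ∣ x m * y m - x n * y n ∣
        ≡⟨ cong ∣_∣ (rearrange (x m) (y m) (x n) (y n)) ⟩
      ∣ y m * (x m - x n) + x n * (y m - y n) ∣
        ≤⟨ ∣p+q∣≤∣p∣+∣q∣ (y m * (x m - x n)) (x n * (y m - y n)) ⟩
      ∣ y m * (x m - x n) ∣ + ∣ x n * (y m - y n) ∣
        <⟨ +-mono-<
             (*-bound {y m} {x m - x n} (y≤C m (ℕ.≤-trans L≤T T≤m)) 0<C
               (x-close m n (ℕ.≤-trans M≤T T≤m) (ℕ.≤-trans M≤T T≤n)))
             (*-bound {x n} {y m - y n} (x≤B n (ℕ.≤-trans K≤T T≤n)) 0<B
               (y-close m n (ℕ.≤-trans N≤T T≤m) (ℕ.≤-trans N≤T T≤n))) ⟩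
      C * δ + B * η
        ≡⟨ cong₂ _+_ Cδ≡ Bη≡ ⟩
      ½ * ε + ½ * ε
        ≡⟨ half+half ε ⟩
      ε ∎

fromℚ : ℚ → ℝ
fromℚ p = mkℝ (λ _ → p) (const-cauchy p)

0ᴿ 1ᴿ : ℝ
0ᴿ = fromℚ 0ℚ
1ᴿ = fromℚ 1ℚ

infixl 6 _+ᴿ_
infixl 7 _*ᴿ_

_+ᴿ_ : ℝ → ℝ → ℝ
x +ᴿ y = mkℝ (λ n → seq x n + seq y n) (+-cauchy {seq x} {seq y} (cauchy x) (cauchy y))

_*ᴿ_ : ℝ → ℝ → ℝ
x *ᴿ y = mkℝ (λ n → seq x n * seq y n) (*-cauchy {seq x} {seq y} (cauchy x) (cauchy y))

+ᴿ-rawMonoid : RawMonoid 0ℓ 0ℓ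
+ᴿ-rawMonoid = record
  { Carrier = ℝ
  ; _≈_     = _≃ᴿ_
  ; _∙_     = _+ᴿ_
  ; ε       = 0ᴿ
  }

open RawMonoidDefinitions +ᴿ-rawMonoid public using (sum)

Matrix : ℕ → Set
Matrix n = Fin n → Fin n → ℝ

infixr 7 _*ᵛ_

_*ᵛ_ : ∀ {n} → Matrix n → Vector ℝ n → Vector ℝ n
(A *ᵛ v) i = sum (λ j → A i j *ᴿ v j)

IsEigenvalue : ∀ {n} → Matrix n → ℝ → Set
IsEigenvalue {n} A μ = Σ[ v ∈ Vector ℝ n ]
  ¬ (∀ i → v i ≃ᴿ 0ᴿ) × (∀ i → (A *ᵛ v) i ≃ᴿ μ *ᴿ v i)

-- Only real eigenvalues are compared, which for a symmetric matrix is
-- all of them.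
IsLargestEigenvalue : ∀ {n} → Matrix n → ℝ → Set
IsLargestEigenvalue A μ =
  IsEigenvalue A μ × (∀ ν → IsEigenvalue A ν → ν ≤ᴿ μ)

record SimpleGraph (n : ℕ) : Set₁ where
  field
    Adj    : Rel (Fin n) 0ℓ
    adj?   : Decidable Adj
    symm   : Symmetric Adj
    irrefl : Irreflexive _≡_ Adj

open SimpleGraph

complement : ∀ {n} → SimpleGraph n → SimpleGraph n
complement G = record
  { Adj    = λ i j → i ≢ j × ¬ Adj G i j
  ; adj?   = λ i j → ¬? (i ≟ j) ×-dec ¬? (adj? G i j)
  ; symm   = λ (i≢j , ¬ij) → i≢j ∘ sym , ¬ij ∘ symm G
  ; irrefl = λ i≡j (i≢j , _) → i≢j i≡j
  }

adjacencyMatrix : ∀ {n} → SimpleGraph n → Matrix n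
adjacencyMatrix G i j = if does (adj? G i j) then 1ᴿ else 0ᴿ

-- The largest eigenvalue is specified by a relation rather than as a function
-- since the graph without vertices has no eigenvalues.
Isλ₁ : ∀ {n} → SimpleGraph n → ℝ → Set
Isλ₁ G = IsLargestEigenvalue (adjacencyMatrix G)

{-# OPTIONS --safe #-}
module Submission where

-- For nonnegative unit vectors x and y and a symmetric 0/1 matrix A we bound
-- xᵀAx + yᵀ(J − A)y by 4n/3; the adjacency matrix of the complement is
-- J − A − I, which accounts for the −1.
--
-- Let C = { i | xᵢ ≥ yᵢ }, c = |C| and d = n − c.  Replacing A by 1 on C × C
-- and by 0 on Cᶜ × Cᶜ only increases the sum, so all that matters is the
-- block M of A between C and Cᶜ.  Write the two quadratic forms as c + e and
-- d + e′, and let S be the number of ones of M, T = cd − S, κ the sum of the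
-- squares of the column sums of M, and κ′ the same for the row sums of J − M.
-- Splitting x on C into its mean and its fluctuation, Cauchy–Schwarz gives
-- (c + e)²e ≤ Se + κ, and likewise (d + e′)²e′ ≤ Te′ + κ′.  The variance of
-- the row sums and of the column sums of M together do not exceed the variance
-- of its entries, so dκ + cκ′ ≤ S² + ST + T².  For positive e and e′ these
-- three inequalities force e + e′ ≤ n/3.

open import Defs hiding (sum)
import Defs
open import Algebra.Bundles using (CommutativeRing)
open import Data.Bool.Base using (Bool; true; false; not; _∧_; if_then_else_)
import Data.Fin.Properties as Fin
open import Data.Fin.Base using (Fin; zero; suc)
open import Data.Integer.Base as ℤ using (+_)
import Data.Integer.Tactic.RingSolver as ℤ-Solver
open import Data.List.Base using ([]; _∷_)
open import Data.Nat.Base as ℕ using (ℕ; zero; suc)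
import Data.Nat.Properties as ℕ
open import Data.Product.Base using (_×_; _,_; proj₁; proj₂; ∃-syntax)
open import Data.Rational.Base
open import Data.Rational.Properties
import Data.Rational.Unnormalised.Base as ℚᵘ
import Data.Rational.Unnormalised.Properties as ℚᵘ
open import Data.Sum.Base using (inj₁; inj₂)
open import Data.Vec.Functional using (Vector)
open import Function.Base using (_∘_)
open import Function.Bundles using (mk⇔)
open import Level using (0ℓ)
open import Relation.Binary.PropositionalEquality
open import Relation.Nullary.Decidable
  using (Dec; yes; no; does; does-⇔; dec-false; dec⇒maybe)
open import Relation.Nullary.Negation using (¬_; contradiction)
open import Tactic.RingSolver using (solve; solve-∀)
open import Tactic.RingSolver.Core.AlmostCommutativeRing
  using (AlmostCommutativeRing; fromCommutativeRing)
open import Algebra.Properties.Semiring.Sum (CommutativeRing.semiring +-*-commutativeRing)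
  using (sum; sum-cong-≗; sum-replicate-zero; ∑-distrib-+; ∑-comm; *-distribˡ-sum; *-distribʳ-sum)

open SimpleGraph

ℚ-ring : AlmostCommutativeRing 0ℓ 0ℓ
ℚ-ring = fromCommutativeRing +-*-commutativeRing (λ p → dec⇒maybe (0ℚ ≟ p))

-- Ordered field arithmetic

≤-by : ∀ {p q r} → 0ℚ ≤ r → q ≡ p + r → p ≤ q
≤-by {p} {r = r} 0≤r refl = subst (_≤ p + r) (+-identityʳ p) (+-monoʳ-≤ p 0≤r)

<-by : ∀ {p q r} → 0ℚ < r → q ≡ p + r → p < q
<-by {p} {r = r} 0<r refl = subst (_< p + r) (+-identityʳ p) (+-monoʳ-< p 0<r)

p≤q⇒0≤q-p : ∀ {p q} → p ≤ q → 0ℚ ≤ q - p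
p≤q⇒0≤q-p {p} {q} p≤q = subst (_≤ q - p) (+-inverseʳ p) (+-monoˡ-≤ (- p) p≤q)

p<q⇒0<q-p : ∀ {p q} → p < q → 0ℚ < q - p
p<q⇒0<q-p {p} {q} p<q = subst (_< q - p) (+-inverseʳ p) (+-monoˡ-< (- p) p<q)

0≤+ : ∀ {p q} → 0ℚ ≤ p → 0ℚ ≤ q → 0ℚ ≤ p + q
0≤+ = +-mono-≤

0<+ : ∀ {p q} → 0ℚ < p → 0ℚ ≤ q → 0ℚ < p + q
0<+ = +-mono-<-≤

0≤* : ∀ {p q} → 0ℚ ≤ p → 0ℚ ≤ q → 0ℚ ≤ p * q
0≤* {p} {q} 0≤p 0≤q =
  nonNegative⁻¹ _ {{nonNeg*nonNeg⇒nonNeg p {{nonNegative 0≤p}} q {{nonNegative 0≤q}}}}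

0<* : ∀ {p q} → 0ℚ < p → 0ℚ < q → 0ℚ < p * q
0<* {p} {q} 0<p 0<q =
  positive⁻¹ _ {{pos*pos⇒pos p {{positive 0<p}} q {{positive 0<q}}}}

0≤p*p : ∀ p → 0ℚ ≤ p * p
0≤p*p p with ≤-total 0ℚ p
... | inj₁ 0≤p = 0≤* 0≤p 0≤p
... | inj₂ p≤0 = nonNegative⁻¹ _
  {{nonPos*nonPos⇒nonPos p {{nonPositive p≤0}} p {{nonPositive p≤0}}}}

0≤p*q⇒0≤q : ∀ {p q} → 0ℚ < p → 0ℚ ≤ p * q → 0ℚ ≤ q
0≤p*q⇒0≤q {p} {q} 0<p 0≤pq =
  *-cancelˡ-≤-pos p {{positive 0<p}} (subst (_≤ p * q) (sym (*-zeroʳ p)) 0≤pq)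

0<p*q⇒0<q : ∀ {p q} → 0ℚ ≤ p → 0ℚ < p * q → 0ℚ < q
0<p*q⇒0<q {p} {q} 0≤p 0<pq =
  *-cancelˡ-<-nonNeg p {{nonNegative 0≤p}} (subst (_< p * q) (sym (*-zeroʳ p)) 0<pq)

≤-cancel-* : ∀ {p q r} → 0ℚ < p → p * q ≤ p * r → q ≤ r
≤-cancel-* {p} 0<p = *-cancelˡ-≤-pos p {{positive 0<p}}

*-mono : ∀ {p q r s} → 0ℚ ≤ p → 0ℚ ≤ s → p ≤ q → r ≤ s → p * r ≤ q * s
*-mono {p} {q} {r} {s} 0≤p 0≤s p≤q r≤s =
  ≤-by (0≤+ (0≤* 0≤p (p≤q⇒0≤q-p r≤s)) (0≤* (p≤q⇒0≤q-p p≤q) 0≤s)) (solve (p ∷ q ∷ r ∷ s ∷ []) ℚ-ring)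

square-cancel-≤ : ∀ {p q} → 0ℚ ≤ q → p * p ≤ q * q → p ≤ q
square-cancel-≤ {p} {q} 0≤q p²≤q² = ≮⇒≥ λ q<p →
  <-irrefl refl (<-≤-trans (q²<p² q<p) p²≤q²)
  where
  q²<p² : q < p → q * q < p * p
  q²<p² q<p = <-by {r = (p - q) * (p - q + (q + q))}
    (0<* (p<q⇒0<q-p q<p) (0<+ (p<q⇒0<q-p q<p) (0≤+ 0≤q 0≤q))) (solve (p ∷ q ∷ []) ℚ-ring)

-- The squares of the two sides differ by (q - r)² + 4(qr - p²). This form of AM-GM avoids square
-- roots, which need not exist in ℚ.
am-gm : ∀ {p q r} → 0ℚ ≤ q → 0ℚ ≤ r → p * p ≤ q * r → p + p ≤ q + r
am-gm {p} {q} {r} 0≤q 0≤r p²≤qr = square-cancel-≤ (0≤+ 0≤q 0≤r)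
  (≤-by (0≤+ (0≤p*p (q - r)) (0≤+ (0≤+ D D) (0≤+ D D))) (solve (p ∷ q ∷ r ∷ []) ℚ-ring))
  where
  D = p≤q⇒0≤q-p p²≤qr

p²≤0⇒p≤0 : ∀ {p} → p * p ≤ 0ℚ → p ≤ 0ℚ
p²≤0⇒p≤0 = square-cancel-≤ ≤-refl

-- The inequality between the parameters

-- With E = h − e and k = c + e − 2h the expression with E in place of e′ is
-- E((3h + E)k² + 4he²) + k²(X − (d + E)E), where X = cd − (c + e)e, and it
-- only grows when E is replaced by e′ > E.
endpoint-pos : ∀ {c h e e′} d → d ≡ h + h + h - c →
  0ℚ < c → 0ℚ < d → 0ℚ < h → 0ℚ < e → 0ℚ < e′ → h < e + e′ →
  (d + e′) * e′ ≤ c * d - (c + e) * e →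
  0ℚ < c * ((d + e′) * (d + e′) * e′) - c * ((c * d - (c + e) * e) * e′)
       - (c * d - (c + e) * e) * (c * d - (c + e) * e)
endpoint-pos {c} {h} {e} {e′} d refl 0<c 0<d 0<h 0<e 0<e′ h<e+e′ μe′≤X =
  subst (0ℚ <_) (final c h e e′)
    (0<+ 0<q (0≤+ (0≤* 0≤x (<⇒≤ 0<R)) (0≤* (0≤* (<⇒≤ 0<c) 0≤x) (<⇒≤ (0<* 0<d+E+d+e′ 0<e′)))))
  where
  X = c * d - (c + e) * e
  E = h - e
  k = c + e - (h + h)
  x = e′ - E

  0<X : 0ℚ < X
  0<X = <-≤-trans (0<* (0<+ 0<d (<⇒≤ 0<e′)) 0<e′) μe′≤X

  X≤0 : h ≤ e → X ≤ 0ℚ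
  X≤0 h≤e = ≤-by (0≤+ (0≤p*p (c - h)) (0≤* (p≤q⇒0≤q-p h≤e) (<⇒≤ (0<+ (0<+ 0<c (<⇒≤ 0<e)) (<⇒≤ 0<h)))))
    (identity c h e)
    where
    identity : ∀ c h e → 0ℚ ≡ c * (h + h + h - c) - (c + e) * e
      + ((c - h) * (c - h) + (e - h) * (c + e + h))
    identity = solve-∀ ℚ-ring

  -- If e ≥ h held, `X≤0` would contradict X ≥ (d + e′)e′ > 0; hence E is positive.
  e<h : e < h
  e<h = ≰⇒> λ h≤e → <-irrefl refl (<-≤-trans 0<X (X≤0 h≤e))

  0<E : 0ℚ < E
  0<E = p<q⇒0<q-p e<h

  0≤x : 0ℚ ≤ x
  0≤x = subst (0ℚ ≤_) (lemma e e′ h) (<⇒≤ (p<q⇒0<q-p h<e+e′))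
    where
    lemma : ∀ e e′ h → e + e′ - h ≡ e′ - (h - e)
    lemma = solve-∀ ℚ-ring

  0≤W : 0ℚ ≤ X - (d + E) * E
  0≤W = subst (0ℚ ≤_) (lemma X d E e′)
    (0≤+ (p≤q⇒0≤q-p μe′≤X) (0≤* 0≤x (<⇒≤ (0<+ 0<d (0≤+ (<⇒≤ 0<e′) (<⇒≤ 0<E))))))
    where
    lemma : ∀ X d E e′ → X - (d + e′) * e′ + (e′ - E) * (d + (e′ + E)) ≡ X - (d + E) * E
    lemma = solve-∀ ℚ-ring

  0<d+E+d+e′ : 0ℚ < d + (E + (d + e′))
  0<d+E+d+e′ = 0<+ 0<d (0≤+ (<⇒≤ 0<E) (0≤+ (<⇒≤ 0<d) (<⇒≤ 0<e′)))

  q = E * ((h + h + h + E) * (k * k) + (h + h + h + h) * (e * e)) + k * k * (X - (d + E) * E)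
  R = c * ((d + E) * (d + E)) - c * X

  0<q : 0ℚ < q
  0<q = 0<+ (0<* 0<E (+-mono-≤-<
           (0≤* (0≤+ (0≤+ (0≤+ 0≤h 0≤h) 0≤h) (<⇒≤ 0<E)) (0≤p*p k))
           (0<* (0<+ (0<+ (0<+ 0<h 0≤h) 0≤h) 0≤h) (0<* 0<e 0<e))))
         (0≤* (0≤p*p k) 0≤W)
    where
    0≤h = <⇒≤ 0<h

  -- Raising E to e′ = E + x adds x R and a further nonnegative term to q. The sign of R follows
  -- from E R = q + X².
  0<R : 0ℚ < R
  0<R = 0<p*q⇒0<q (<⇒≤ 0<E) (subst (0ℚ <_) (lemma c h e) (0<+ 0<q (0≤p*p X)))
    where
    lemma : ∀ c h e → let d = h + h + h - c; X = c * d - (c + e) * e; E = h - e; k = c + e - (h + h) in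
      E * ((h + h + h + E) * (k * k) + (h + h + h + h) * (e * e)) + k * k * (X - (d + E) * E) + X * X
      ≡ E * (c * ((d + E) * (d + E)) - c * X)
    lemma = solve-∀ ℚ-ring

  final : ∀ c h e e′ → let d = h + h + h - c; X = c * d - (c + e) * e; E = h - e; k = c + e - (h + h); x = e′ - E in
    E * ((h + h + h + E) * (k * k) + (h + h + h + h) * (e * e)) + k * k * (X - (d + E) * E)
    + (x * (c * ((d + E) * (d + E)) - c * X) + c * x * ((d + (E + (d + e′))) * e′))
    ≡ c * ((d + e′) * (d + e′) * e′) - c * (X * e′) - X * X
  final = solve-∀ ℚ-ring

-- The three inequalities combine to G ≥ 0 for a polynomial G that is convex in
-- S, which ranges over [(c + e)e , cd − (d + e′)e′].  At the end points G is
-- −G₀ and −G₁, both negative by endpoint-pos if e + e′ > h.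
eigenvalue-bound : ∀ {c h e e′ S κ κ′} d → d ≡ h + h + h - c → 0ℚ < c → 0ℚ < d → 0ℚ < h →
  0ℚ < e → 0ℚ < e′ →
  (c + e) * (c + e) * e ≤ S * e + κ →
  (d + e′) * (d + e′) * e′ ≤ (c * d - S) * e′ + κ′ →
  (c + e) * e ≤ S →
  (d + e′) * e′ ≤ c * d - S →
  d * κ + c * κ′ ≤ c * d * (c * d - S) + S * S →
  e + e′ ≤ h
eigenvalue-bound {c} {h} {e} {e′} {S} {κ} {κ′} d d≡ 0<c 0<d 0<h 0<e 0<e′ cubic cubic′ λe≤S μe′≤T variance =
  ≮⇒≥ λ h<e+e′ → contradiction refl (<⇒≢ (0<0 h<e+e′))
  where
  α = S - (c + e) * e
  β = c * d - S - (d + e′) * e′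
  G = c * d * (c * d - S) + S * S + (d * (S * e) + c * ((c * d - S) * e′))
      - (d * ((c + e) * (c + e) * e) + c * ((d + e′) * (d + e′) * e′))
  G₀ = c * ((d + e′) * (d + e′) * e′) - c * ((c * d - (c + e) * e) * e′)
       - (c * d - (c + e) * e) * (c * d - (c + e) * e)
  G₁ = d * ((c + e) * (c + e) * e) - d * ((d * c - (d + e′) * e′) * e)
       - (d * c - (d + e′) * e′) * (d * c - (d + e′) * e′)

  0≤α : 0ℚ ≤ α
  0≤α = p≤q⇒0≤q-p λe≤S

  0≤β : 0ℚ ≤ β
  0≤β = p≤q⇒0≤q-p μe′≤T

  -- Adding d times `cubic`, c times `cubic′` and `variance` cancels κ and κ′.
  0≤G : 0ℚ ≤ G
  0≤G = subst (0ℚ ≤_) (identity c d e e′ S κ κ′)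
    (0≤+ (p≤q⇒0≤q-p variance) (0≤+ (0≤* (<⇒≤ 0<d) (p≤q⇒0≤q-p cubic)) (0≤* (<⇒≤ 0<c) (p≤q⇒0≤q-p cubic′))))
    where
    identity : ∀ c d e e′ S κ κ′ →
      c * d * (c * d - S) + S * S - (d * κ + c * κ′)
      + (d * (S * e + κ - (c + e) * (c + e) * e)
         + c * ((c * d - S) * e′ + κ′ - (d + e′) * (d + e′) * e′))
      ≡ c * d * (c * d - S) + S * S + (d * (S * e) + c * ((c * d - S) * e′))
        - (d * ((c + e) * (c + e) * e) + c * ((d + e′) * (d + e′) * e′))
    identity = solve-∀ ℚ-ring

  0<G₀ : h < e + e′ → 0ℚ < G₀
  0<G₀ h<e+e′ = endpoint-pos d d≡ 0<c 0<d 0<h 0<e 0<e′ h<e+e′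
    (≤-by (0≤+ 0≤α 0≤β) (identity c d e e′ S))
    where
    identity : ∀ c d e e′ S → c * d - (c + e) * e
      ≡ (d + e′) * e′ + (S - (c + e) * e + (c * d - S - (d + e′) * e′))
    identity = solve-∀ ℚ-ring

  0<G₁ : h < e + e′ → 0ℚ < G₁
  0<G₁ h<e+e′ = endpoint-pos c (trans (c≡ h c) (cong (λ x → h + h + h - x) (sym d≡))) 0<d 0<c 0<h 0<e′ 0<e
    (subst (h <_) (+-comm e e′) h<e+e′)
    (≤-by (0≤+ 0≤α 0≤β) (identity c d e e′ S))
    where
    c≡ : ∀ h c → c ≡ h + h + h - (h + h + h - c)
    c≡ = solve-∀ ℚ-ring
    identity : ∀ c d e e′ S → d * c - (d + e′) * e′
      ≡ (c + e) * e + (S - (c + e) * e + (c * d - S - (d + e′) * e′))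
    identity = solve-∀ ℚ-ring

  0<0 : h < e + e′ → 0ℚ < 0ℚ
  0<0 h<e+e′ with 0ℚ <? α
  -- G is quadratic in S with leading coefficient 1, so G + αβ interpolates linearly between the end
  -- values: (α + β)(G + αβ) = -β G₀ - α G₁.
  ... | yes 0<α = subst (0ℚ <_) (identity c d e e′ S)
    (+-mono-<-≤ (+-mono-≤-< (0≤* 0≤β (<⇒≤ (0<G₀ h<e+e′))) (0<* 0<α (0<G₁ h<e+e′)))
      (0≤* (0≤+ 0≤α 0≤β) (0≤+ (0≤* 0≤α 0≤β) 0≤G)))
    where
      identity : ∀ c d e e′ S →
        let α = S - (c + e) * e
            β = c * d - S - (d + e′) * e′
            G = c * d * (c * d - S) + S * S + (d * (S * e) + c * ((c * d - S) * e′))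
                - (d * ((c + e) * (c + e) * e) + c * ((d + e′) * (d + e′) * e′))
            G₀ = c * ((d + e′) * (d + e′) * e′) - c * ((c * d - (c + e) * e) * e′)
                 - (c * d - (c + e) * e) * (c * d - (c + e) * e)
            G₁ = d * ((c + e) * (c + e) * e) - d * ((d * c - (d + e′) * e′) * e)
                 - (d * c - (d + e′) * e′) * (d * c - (d + e′) * e′)
        in β * G₀ + α * G₁ + (α + β) * (α * β + G) ≡ 0ℚ
      identity = solve-∀ ℚ-ring
  -- For α = 0 both interpolation weights may vanish, so the end value is used directly: G₀ + G is a
  -- multiple of α.
  ... | no 0≮α = subst (0ℚ <_)
    (trans (identity c d e e′ S) (trans (cong (_* F) α≡0) (*-zeroˡ F)))
    (0<+ (0<G₀ h<e+e′) 0≤G)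
    where
      F = S + (c + e) * e - c * d + d * e - c * e′
      α≡0 : α ≡ 0ℚ
      α≡0 = ≤-antisym (≮⇒≥ 0≮α) 0≤α
      identity : ∀ c d e e′ S →
        c * ((d + e′) * (d + e′) * e′) - c * ((c * d - (c + e) * e) * e′)
        - (c * d - (c + e) * e) * (c * d - (c + e) * e)
        + (c * d * (c * d - S) + S * S + (d * (S * e) + c * ((c * d - S) * e′))
           - (d * ((c + e) * (c + e) * e) + c * ((d + e′) * (d + e′) * e′)))
        ≡ (S - (c + e) * e) * (S + (c + e) * e - c * d + d * e - c * e′)
      identity = solve-∀ ℚ-ring

-- From c = 3h - d follows cd = (d + h)h - (d - h)² ≤ (d + h)h, and (d + e′)e′ would exceed this if
-- e′ > h.
one-sided-bound : ∀ {c h e e′ S} d → d ≡ h + h + h - c → 0ℚ ≤ d → 0ℚ ≤ h → 0ℚ ≤ S → e ≤ 0ℚ →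
  (d + e′) * e′ ≤ c * d - S → e + e′ ≤ h
one-sided-bound {c} {h} {e} {e′} {S} d refl 0≤d 0≤h 0≤S e≤0 μe′≤T = ≤-trans
  (subst (e + e′ ≤_) (+-identityˡ e′) (+-monoˡ-≤ e′ e≤0))
  (≮⇒≥ λ h<e′ → contradiction refl (<⇒≢ (0<0 h<e′)))
  where
  0<0 : h < e′ → 0ℚ < 0ℚ
  0<0 h<e′ = <-≤-trans (+-mono-<-≤
      (0<* (p<q⇒0<q-p h<e′) (+-mono-<-≤ (≤-<-trans 0≤h h<e′) (0≤+ 0≤h 0≤d)))
      (0≤+ (0≤p*p (d - h)) (0≤+ 0≤S (p≤q⇒0≤q-p μe′≤T))))
    (≤-reflexive (identity c h e′ S))
    where
    identity : ∀ c h e′ S → let d = h + h + h - c in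
      (e′ - h) * (e′ + (h + d)) + ((d - h) * (d - h) + (S + (c * d - S - (d + e′) * e′))) ≡ 0ℚ
    identity = solve-∀ ℚ-ring

-- Finite sums

sum-mono-≤ : ∀ {n} {f g : Vector ℚ n} → (∀ i → f i ≤ g i) → sum f ≤ sum g
sum-mono-≤ {zero}  f≤g = ≤-refl
sum-mono-≤ {suc n} f≤g = +-mono-≤ (f≤g zero) (sum-mono-≤ (f≤g ∘ suc))

0≤sum : ∀ {n} {f : Vector ℚ n} → (∀ i → 0ℚ ≤ f i) → 0ℚ ≤ sum f
0≤sum {n} {f} 0≤f = subst (_≤ sum f) (sum-replicate-zero n) (sum-mono-≤ 0≤f)

term≤sum : ∀ {n} {f : Vector ℚ n} → (∀ i → 0ℚ ≤ f i) → ∀ i → f i ≤ sum f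
term≤sum {f = f} 0≤f zero    = subst (_≤ sum f) (+-identityʳ (f zero))
  (+-monoʳ-≤ (f zero) (0≤sum (0≤f ∘ suc)))
term≤sum {f = f} 0≤f (suc i) = subst (_≤ sum f) (+-identityˡ (f (suc i)))
  (+-mono-≤ (0≤f zero) (term≤sum (0≤f ∘ suc) i))

sum-linear : ∀ {n} p q (f g : Vector ℚ n) →
  sum (λ i → p * f i + q * g i) ≡ p * sum f + q * sum g
sum-linear p q f g = trans (∑-distrib-+ (λ i → p * f i) (λ i → q * g i))
  (sym (cong₂ _+_ (*-distribˡ-sum p f) (*-distribˡ-sum q g)))

-- Induction on the length; the mixed term 2abs is bounded by `am-gm` applied to a²B and b²A.
cauchy-schwarz : ∀ {n} (f g : Vector ℚ n) →
  sum (λ i → f i * g i) * sum (λ i → f i * g i) ≤ sum (λ i → f i * f i) * sum (λ i → g i * g i)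
cauchy-schwarz {zero}  f g = ≤-refl
cauchy-schwarz {suc n} f g = step (f zero) (g zero) (cauchy-schwarz (f ∘ suc) (g ∘ suc))
  (0≤sum (λ i → 0≤p*p (f (suc i)))) (0≤sum (λ i → 0≤p*p (g (suc i))))
  where
  step : ∀ a b {s A B} → s * s ≤ A * B → 0ℚ ≤ A → 0ℚ ≤ B →
         (a * b + s) * (a * b + s) ≤ (a * a + A) * (b * b + B)
  step a b {s} {A} {B} s²≤AB 0≤A 0≤B = ≤-by
    (0≤+ (p≤q⇒0≤q-p s²≤AB) (p≤q⇒0≤q-p cross)) (expand a b s A B)
    where
    square : ∀ a b s A B →
      a * a * B * (b * b * A) ≡ a * b * s * (a * b * s) + a * b * (a * b) * (A * B - s * s)
    square = solve-∀ ℚ-ring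
    cross : a * b * s + a * b * s ≤ a * a * B + b * b * A
    cross = am-gm {p = a * b * s} (0≤* (0≤p*p a) 0≤B) (0≤* (0≤p*p b) 0≤A)
      (≤-by (0≤* (0≤p*p (a * b)) (p≤q⇒0≤q-p s²≤AB)) (square a b s A B))
    expand : ∀ a b s A B → (a * a + A) * (b * b + B) ≡ (a * b + s) * (a * b + s)
      + (A * B - s * s + (a * a * B + b * b * A - (a * b * s + a * b * s)))
    expand = solve-∀ ℚ-ring

-- `c * f i - F * χ i` is c times the component of f orthogonal to χ. For χ an indicator and f
-- supported on its set, this is the deviation from the mean, scaled by c to avoid division.
sum-centred : ∀ {n} (χ f g : Vector ℚ n) {c F G} →
  sum (λ i → χ i * χ i) ≡ c → sum (λ i → χ i * f i) ≡ F → sum (λ i → χ i * g i) ≡ G →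
  sum (λ i → (c * f i - F * χ i) * (c * g i - G * χ i)) ≡ c * (c * sum (λ i → f i * g i) - F * G)
sum-centred χ f g {c} {F} {G} refl refl refl = begin
  sum (λ i → (c * f i - F * χ i) * (c * g i - G * χ i))
    ≡⟨ sum-cong-≗ (λ i → expand c F G (χ i) (f i) (g i)) ⟩
  sum (λ i → 1ℚ * (c * c * (f i * g i) + F * G * (χ i * χ i)) + - c * (G * (χ i * f i) + F * (χ i * g i)))
    ≡⟨ sum-linear 1ℚ (- c) (λ i → c * c * (f i * g i) + F * G * (χ i * χ i))
         (λ i → G * (χ i * f i) + F * (χ i * g i)) ⟩
  1ℚ * sum (λ i → c * c * (f i * g i) + F * G * (χ i * χ i)) + - c * sum (λ i → G * (χ i * f i) + F * (χ i * g i))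
    ≡⟨ cong₂ (λ x y → 1ℚ * x + - c * y)
         (sum-linear (c * c) (F * G) (λ i → f i * g i) (λ i → χ i * χ i))
         (sum-linear G F (λ i → χ i * f i) (λ i → χ i * g i)) ⟩
  1ℚ * (c * c * sum (λ i → f i * g i) + F * G * c) + - c * (G * F + F * G)
    ≡⟨ collect c F G (sum (λ i → f i * g i)) ⟩
  c * (c * sum (λ i → f i * g i) - F * G) ∎
  where
  open ≡-Reasoning
  expand : ∀ c F G x f g → (c * f - F * x) * (c * g - G * x)
    ≡ 1ℚ * (c * c * (f * g) + F * G * (x * x)) + - c * (G * (x * f) + F * (x * g))
  expand = solve-∀ ℚ-ring
  collect : ∀ c F G H → 1ℚ * (c * c * H + F * G * c) + - c * (G * F + F * G) ≡ c * (c * H - F * G)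
  collect = solve-∀ ℚ-ring

-- Variance and covariance relative to a fixed vector

module _ {n} (χ : Vector ℚ n) {c} (0<c : 0ℚ < c) (Σχ²≡c : sum (λ i → χ i * χ i) ≡ c) where

  0≤variance : ∀ (f : Vector ℚ n) {F} → sum (λ i → χ i * f i) ≡ F →
    0ℚ ≤ c * sum (λ i → f i * f i) - F * F
  0≤variance f {F} Σχf≡F = 0≤p*q⇒0≤q 0<c
    (subst (0ℚ ≤_) (sum-centred χ f f Σχ²≡c Σχf≡F Σχf≡F)
      (0≤sum (λ i → 0≤p*p (c * f i - F * χ i))))

  -- Cauchy-Schwarz for the components orthogonal to χ, with the common factor c² cancelled.
  covariance²≤variance*variance : ∀ (f g : Vector ℚ n) {F G} →
    sum (λ i → χ i * f i) ≡ F → sum (λ i → χ i * g i) ≡ G →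
    (c * sum (λ i → f i * g i) - F * G) * (c * sum (λ i → f i * g i) - F * G) ≤
    (c * sum (λ i → f i * f i) - F * F) * (c * sum (λ i → g i * g i) - G * G)
  covariance²≤variance*variance f g {F} {G} Σχf≡F Σχg≡G = ≤-cancel-* (0<* 0<c 0<c)
    (subst₂ _≤_
      (trans (cong (λ x → x * x) (sum-centred χ f g Σχ²≡c Σχf≡F Σχg≡G)) (regroup c _ _))
      (trans (cong₂ _*_ (sum-centred χ f f Σχ²≡c Σχf≡F Σχf≡F) (sum-centred χ g g Σχ²≡c Σχg≡G Σχg≡G))
        (regroup c _ _))
      (cauchy-schwarz (λ i → c * f i - F * χ i) (λ i → c * g i - G * χ i)))
    where
    regroup : ∀ c x y → c * x * (c * y) ≡ c * c * (x * y)
    regroup = solve-∀ ℚ-ring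

-- Here u is supported on a set of size c with mean F/c, V is the sum of Mz over
-- that set and W = ⟨u, Mz⟩, so that W splits into FV/c and a covariance.
cubic-bound : ∀ {c e F U V W Z S κ} → 0ℚ < c → 0ℚ < e → 0ℚ ≤ Z → 0ℚ ≤ κ →
  0ℚ ≤ c * U - F * F → 0ℚ ≤ c * S - κ → V * V ≤ κ * Z →
  (c * W - F * V) * (c * W - F * V) ≤ (c * U - F * F) * (Z * (c * S - κ)) →
  0ℚ < U + Z → (c + e) * (U + Z) ≤ F * F + (W + W) →
  (c + e) * (c + e) * e ≤ S * e + κ
cubic-bound {c} {e} {F} {U} {V} {W} {Z} {S} {κ} 0<c 0<e 0≤Z 0≤κ 0≤H 0≤L V²≤κZ Q²≤HZL 0<U+Z rayleigh
  with 0ℚ <? Z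
... | yes 0<Z = ≤-by (0≤p*q⇒0≤q (0<* 0<Z 0<c) (subst (0ℚ ≤_) (combine c e F U V W Z S κ)
        (0≤+ (0≤* 0≤l (p≤q⇒0≤q-p slack₁)) (0≤+ (0≤* 0≤e (p≤q⇒0≤q-p slack₂)) 
          (0≤* (0≤* 0≤e 0≤l) (0≤* 0≤c (p≤q⇒0≤q-p rayleigh)))))))
      (regroup c e S κ)
  where
  l = c + e
  H = c * U - F * F
  L = c * S - κ
  Q = c * W - F * V
  0≤c = <⇒≤ 0<c
  0≤e = <⇒≤ 0<e
  0≤l = <⇒≤ (0<+ 0<c 0≤e)
  -- AM-GM is applied to FV with weight e and to Q with weight c + e. With these weights every term
  -- of `combine` that lacks the factor Z cancels.
  slack₁ : e * (F * V) + e * (F * V) ≤ e * e * (F * F) + κ * Z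
  slack₁ = am-gm {p = e * (F * V)} (0≤* (0≤p*p e) (0≤p*p F)) (0≤* 0≤κ 0≤Z)
    (≤-by (0≤* (0≤p*p (e * F)) (p≤q⇒0≤q-p V²≤κZ)) (identity e F V (κ * Z)))
    where
    identity : ∀ e F V X → e * e * (F * F) * X ≡ e * (F * V) * (e * (F * V)) + e * F * (e * F) * (X - V * V)
    identity = solve-∀ ℚ-ring
  slack₂ : l * Q + l * Q ≤ l * l * H + Z * L
  slack₂ = am-gm {p = l * Q} (0≤* (0≤p*p l) 0≤H) (0≤* 0≤Z 0≤L)
    (≤-by (0≤* (0≤p*p l) (p≤q⇒0≤q-p Q²≤HZL)) (identity l Q H (Z * L)))
    where
    identity : ∀ l Q H X → l * l * H * X ≡ l * Q * (l * Q) + l * l * (H * X - Q * Q)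
    identity = solve-∀ ℚ-ring
  combine : ∀ c e F U V W Z S κ → let l = c + e; H = c * U - F * F; L = c * S - κ; Q = c * W - F * V in
    l * (e * e * (F * F) + κ * Z - (e * (F * V) + e * (F * V)))
    + (e * (l * l * H + Z * L - (l * Q + l * Q)) + e * l * (c * (F * F + (W + W) - l * (U + Z))))
    ≡ Z * c * (S * e + κ - l * l * e)
  combine = solve-∀ ℚ-ring
  regroup : ∀ c e S κ → S * e + κ ≡ (c + e) * (c + e) * e + (S * e + κ - (c + e) * (c + e) * e)
  regroup = solve-∀ ℚ-ring
-- If Z = 0, then FV ≤ 0 and cW - FV ≤ 0, so W ≤ 0. The Rayleigh inequality then gives (c + e)U ≤ F²
-- ≤ cU, against e > 0 and U > 0.
... | no 0≮Z = contradiction refl (<⇒≢ (subst (0ℚ <_) (identity c e F U V W Z)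
        (0<+ {c * e * (U + Z)} (0<* (0<* 0<c 0<e) (0<U+Z))
          (0≤+ (0≤* (<⇒≤ 0<c) (p≤q⇒0≤q-p rayleigh)) (0≤+ (0≤* (<⇒≤ 0<c) 0≤H)
          (0≤+ (0≤* (0≤p*p c) 0≤Z) (0≤+ (p≤q⇒0≤q-p FV≤0) (0≤+ (p≤q⇒0≤q-p FV≤0) (0≤+ (p≤q⇒0≤q-p Q≤0) (p≤q⇒0≤q-p Q≤0))))))))))
  where
  Z≡0 : Z ≡ 0ℚ
  Z≡0 = ≤-antisym (≮⇒≥ 0≮Z) 0≤Z
  FV≤0 : F * V ≤ 0ℚ
  FV≤0 = p²≤0⇒p≤0 {F * V} (≤-by {F * V * (F * V)} {0ℚ} (0≤* (0≤p*p F) (p≤q⇒0≤q-p V²≤κZ))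
    (trans (trans (sym (*-zeroʳ (F * F * κ))) (cong (F * F * κ *_) (sym Z≡0))) (id₁ F V κ Z)))
    where
    id₁ : ∀ F V κ Z → F * F * κ * Z ≡ F * V * (F * V) + F * F * (κ * Z - V * V)
    id₁ = solve-∀ ℚ-ring
  Q≤0 : c * W - F * V ≤ 0ℚ
  Q≤0 = p²≤0⇒p≤0 {c * W - F * V} (subst ((c * W - F * V) * (c * W - F * V) ≤_)
    (trans (cong (λ z → (c * U - F * F) * (z * (c * S - κ))) Z≡0) (id₂ (c * U - F * F) (c * S - κ))) Q²≤HZL)
    where
    id₂ : ∀ H L → H * (0ℚ * L) ≡ 0ℚ
    id₂ = solve-∀ ℚ-ring
  identity : ∀ c e F U V W Z →
    c * e * (U + Z) + (c * (F * F + (W + W) - (c + e) * (U + Z)) + (c * (c * U - F * F)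
      + (c * c * Z + (0ℚ - F * V + (0ℚ - F * V
      + (0ℚ - (c * W - F * V) + (0ℚ - (c * W - F * V)))))))) ≡ 0ℚ
  identity = solve-∀ ℚ-ring

-- The block of a 0/1 matrix with rows in a given set

module _ {n} (χ : Vector ℚ n) (m : Fin n → Vector ℚ n)
  (χ-idem : ∀ i → χ i * χ i ≡ χ i) (m-idem : ∀ i j → m i j * m i j ≡ m i j)
  (χm≡m : ∀ i j → χ i * m i j ≡ m i j) where

  private
    c = sum χ
    row col : Vector ℚ n
    row i = sum (m i)
    col j = sum (λ i → m i j)
    S = sum row
    κ = sum (λ j → col j * col j)

    infixr 7 m·_
    m·_ : Vector ℚ n → Vector ℚ n
    (m· z) i = sum (λ j → m i j * z j)

    Σχ²≡c : sum (λ i → χ i * χ i) ≡ c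
    Σχ²≡c = sum-cong-≗ χ-idem

    Σcol≡S : sum col ≡ S
    Σcol≡S = ∑-comm (λ j i → m i j)

    Σm·≡Σcol* : ∀ z → sum (m· z) ≡ sum (λ j → col j * z j)
    Σm·≡Σcol* z = trans (∑-comm (λ i j → m i j * z j))
      (sum-cong-≗ (λ j → sym (*-distribʳ-sum (z j) (λ i → m i j))))

    χm·≡m· : ∀ z i → χ i * (m· z) i ≡ (m· z) i
    χm·≡m· z i = trans (*-distribˡ-sum (χ i) (λ j → m i j * z j))
      (sum-cong-≗ (λ j → trans (sym (*-assoc (χ i) (m i j) (z j))) (cong (_* z j) (χm≡m i j))))

    0≤χ : ∀ i → 0ℚ ≤ χ i
    0≤χ i = subst (0ℚ ≤_) (χ-idem i) (0≤p*p (χ i))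

    0≤c : 0ℚ ≤ c
    0≤c = 0≤sum 0≤χ

    0≤κ : 0ℚ ≤ κ
    0≤κ = 0≤sum (λ j → 0≤p*p (col j))

    -- Cauchy-Schwarz against χ; the entries are idempotent, so the squared norm of a column is its
    -- sum.
    col²≤c*col : ∀ j → col j * col j ≤ c * col j
    col²≤c*col j = subst₂ _≤_
      (cong (λ x → x * x) (sum-cong-≗ (λ i → χm≡m i j)))
      (cong₂ _*_ Σχ²≡c (sum-cong-≗ (λ i → m-idem i j)))
      (cauchy-schwarz χ (λ i → m i j))

    κ≤c*S : κ ≤ c * S
    κ≤c*S = subst (κ ≤_) (trans (sym (*-distribˡ-sum c col)) (cong (c *_) Σcol≡S))
      (sum-mono-≤ col²≤c*col)

    [Σm·]²≤κ*Σz² : ∀ z → sum (m· z) * sum (m· z) ≤ κ * sum (λ j → z j * z j)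
    [Σm·]²≤κ*Σz² z = subst (λ V → V * V ≤ κ * sum (λ j → z j * z j)) (sym (Σm·≡Σcol* z))
      (cauchy-schwarz col z)

  -- `D` is c times the deviation of the entries from their column means on the rows of χ. Centring
  -- Mz amounts to applying `D` to z, so Cauchy-Schwarz in each row bounds it by the norm of `D`; as
  -- the entries are 0/1, that norm depends only on the column sums.
  variance-m· : 0ℚ < c → ∀ z →
    c * sum (λ i → (m· z) i * (m· z) i) - sum (m· z) * sum (m· z) ≤
    sum (λ j → z j * z j) * (c * S - κ)
  variance-m· 0<c z = ≤-cancel-* 0<c (begin
    c * (c * sum (λ i → (m· z) i * (m· z) i) - sum (m· z) * sum (m· z))
      ≡⟨ sum-centred χ (m· z) (m· z) Σχ²≡c (sum-cong-≗ (χm·≡m· z)) (sum-cong-≗ (χm·≡m· z)) ⟨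
    sum (λ i → (c * (m· z) i - sum (m· z) * χ i) * (c * (m· z) i - sum (m· z) * χ i))
      ≡⟨ sum-cong-≗ (λ i → cong (λ x → x * x) (centred-m· i)) ⟩
    sum (λ i → sum (λ j → D i j * z j) * sum (λ j → D i j * z j))
      ≤⟨ sum-mono-≤ (λ i → cauchy-schwarz (D i) z) ⟩
    sum (λ i → sum (λ j → D i j * D i j) * Z)
      ≡⟨ *-distribʳ-sum Z (λ i → sum (λ j → D i j * D i j)) ⟨
    sum (λ i → sum (λ j → D i j * D i j)) * Z
      ≡⟨ cong (_* Z) (trans (∑-comm (λ i j → D i j * D i j)) ΣΣD²) ⟩
    c * (c * S - κ) * Z
      ≡⟨ regroup c (c * S - κ) Z ⟩
    c * (Z * (c * S - κ)) ∎)
    where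
    open ≤-Reasoning
    Z = sum (λ j → z j * z j)
    D : Fin n → Vector ℚ n
    D i j = c * m i j - col j * χ i

    regroup : ∀ c L Z → c * L * Z ≡ c * (Z * L)
    regroup = solve-∀ ℚ-ring

    centred-m· : ∀ i → c * (m· z) i - sum (m· z) * χ i ≡ sum (λ j → D i j * z j)
    centred-m· i = trans (trans (cong (λ V → c * (m· z) i - V * χ i) (Σm·≡Σcol* z))
        (to-linear c (χ i) _ _))
      (trans (sym (sum-linear c (- χ i) (λ j → m i j * z j) (λ j → col j * z j)))
        (sum-cong-≗ (λ j → from-linear c (χ i) (m i j) (col j) (z j))))
      where
      to-linear : ∀ c x b V → c * b - V * x ≡ c * b + - x * V
      to-linear = solve-∀ ℚ-ring
      from-linear : ∀ c x m k z → c * (m * z) + - x * (k * z) ≡ (c * m - k * x) * z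
      from-linear = solve-∀ ℚ-ring

    ΣΣD² : sum (λ j → sum (λ i → D i j * D i j)) ≡ c * (c * S - κ)
    ΣΣD² = trans (sum-cong-≗ column)
      (trans (sum-linear (c * c) (- c) col (λ j → col j * col j))
        (trans (cong (λ s → c * c * s + - c * κ) Σcol≡S) (factor c S κ)))
      where
      column : ∀ j → sum (λ i → D i j * D i j) ≡ c * c * col j + - c * (col j * col j)
      column j = trans
        (sum-centred χ (λ i → m i j) (λ i → m i j) Σχ²≡c
          (sum-cong-≗ (λ i → χm≡m i j)) (sum-cong-≗ (λ i → χm≡m i j)))
        (trans (cong (λ s → c * (c * s - col j * col j)) (sum-cong-≗ (λ i → m-idem i j)))
          (expand c (col j)))
        where
        expand : ∀ c k → c * (c * k - k * k) ≡ c * c * k + - c * (k * k)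
        expand = solve-∀ ℚ-ring
      factor : ∀ c S κ → c * c * S + - c * κ ≡ c * (c * S - κ)
      factor = solve-∀ ℚ-ring

  module _ (u z : Vector ℚ n) (χu≡u : ∀ i → χ i * u i ≡ u i) {e} (0<e : 0ℚ < e)
    (0<U+Z : 0ℚ < sum (λ i → u i * u i) + sum (λ j → z j * z j))
    (rayleigh : (c + e) * (sum (λ i → u i * u i) + sum (λ j → z j * z j)) ≤
                sum u * sum u + (sum (λ i → u i * (m· z) i) + sum (λ i → u i * (m· z) i)))
    where

    private
      U = sum (λ i → u i * u i)
      Z = sum (λ j → z j * z j)
      W = sum (λ i → u i * (m· z) i)

    -- An empty set would force u = 0, and then the right side of `rayleigh` vanishes while the left
    -- side is positive.
    0<size : 0ℚ < c
    0<size = ≰⇒> λ c≤0 → contradiction refl (<⇒≢ (0<0 c≤0))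
      where
      u≡0 : c ≤ 0ℚ → ∀ i → u i ≡ 0ℚ
      u≡0 c≤0 i = trans (sym (χu≡u i)) (trans
        (cong (_* u i) (≤-antisym (≤-trans (term≤sum 0≤χ i) c≤0) (0≤χ i))) (*-zeroˡ (u i)))
      0<0 : c ≤ 0ℚ → 0ℚ < 0ℚ
      0<0 c≤0 = <-≤-trans (0<* (+-mono-≤-< 0≤c 0<e) 0<U+Z) (subst ((c + e) * (U + Z) ≤_)
        (cong₂ (λ F W → F * F + (W + W))
          (trans (sum-cong-≗ (u≡0 c≤0)) (sum-replicate-zero n))
          (trans (sum-cong-≗ (λ i → trans (cong (_* (m· z) i) (u≡0 c≤0 i)) (*-zeroˡ ((m· z) i))))
            (sum-replicate-zero n)))
        rayleigh)

    eigenvalue-cubic : (c + e) * (c + e) * e ≤ S * e + κ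
    eigenvalue-cubic = cubic-bound {F = sum u} {V = sum (m· z)} {W = W} 0<size 0<e
      (0≤sum (λ j → 0≤p*p (z j))) 0≤κ 0≤varU (p≤q⇒0≤q-p κ≤c*S) ([Σm·]²≤κ*Σz² z)
      (≤-trans (covariance²≤variance*variance χ 0<size Σχ²≡c u (m· z) (sum-cong-≗ χu≡u) (sum-cong-≗ (χm·≡m· z)))
        (*-monoˡ-≤-nonNeg (c * U - sum u * sum u) {{nonNegative 0≤varU}} (variance-m· 0<size z)))
      0<U+Z rayleigh
      where
      0≤varU = 0≤variance χ 0<size Σχ²≡c u (sum-cong-≗ χu≡u)

    -- The cubic inequality with κ replaced by its upper bound cS, divided by c + e. It confines S
    -- to the interval on which the convexity argument runs.
    eigenvalue-quadratic : (c + e) * e ≤ S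
    eigenvalue-quadratic = ≤-cancel-* (0<+ 0<size (<⇒≤ 0<e))
      (≤-by (0≤+ (p≤q⇒0≤q-p eigenvalue-cubic) (p≤q⇒0≤q-p κ≤c*S)) (identity c e S κ))
      where
      identity : ∀ c e S κ → (c + e) * S ≡
        (c + e) * ((c + e) * e) + (S * e + κ - (c + e) * (c + e) * e + (c * S - κ))
      identity = solve-∀ ℚ-ring

  -- Take z to be the indicator ψ of the columns: then Mz consists of the row sums. This is the
  -- bound on row and column variances by the variance of the entries.
  row-variance : 0ℚ < c → ∀ ψ → (∀ i j → m i j * ψ j ≡ m i j) →
    c * sum (λ i → row i * row i) - S * S ≤ sum (λ j → ψ j * ψ j) * (c * S - κ)
  row-variance 0<c ψ mψ≡m = subst (_≤ sum (λ j → ψ j * ψ j) * (c * S - κ))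
    (cong₂ (λ ρ V → c * ρ - V * V)
      (sum-cong-≗ (λ i → cong (λ x → x * x) (m·ψ≡row i))) (sum-cong-≗ m·ψ≡row))
    (variance-m· 0<c ψ)
    where
    m·ψ≡row : ∀ i → (m· ψ) i ≡ row i
    m·ψ≡row i = sum-cong-≗ (mψ≡m i)

-- Pairs of nonnegative vectors

⟦_⟧ : Bool → ℚ
⟦ b ⟧ = if b then 1ℚ else 0ℚ

⟦⟧-idem : ∀ b → ⟦ b ⟧ * ⟦ b ⟧ ≡ ⟦ b ⟧
⟦⟧-idem true  = refl
⟦⟧-idem false = refl

0≤⟦⟧ : ∀ b → 0ℚ ≤ ⟦ b ⟧
0≤⟦⟧ b = subst (0ℚ ≤_) (⟦⟧-idem b) (0≤p*p ⟦ b ⟧)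

⟦⟧-complement : ∀ b → ⟦ b ⟧ + ⟦ not b ⟧ ≡ 1ℚ
⟦⟧-complement true  = refl
⟦⟧-complement false = refl

quadratic-form : ∀ {n} → (Fin n → Vector ℚ n) → Vector ℚ n → ℚ
quadratic-form m u = sum (λ i → sum (λ j → m i j * (u i * u j)))

sum-ones : ℕ → ℚ
sum-ones n = sum {n} (λ _ → 1ℚ)

0<3 : 0ℚ < 1ℚ + 1ℚ + 1ℚ
0<3 = positive⁻¹ (1ℚ + 1ℚ + 1ℚ)

triple : ∀ p → p + p + p ≡ (1ℚ + 1ℚ + 1ℚ) * p
triple = solve-∀ ℚ-ring

-- With q / r a Rayleigh quotient and p the size of a class, e is the excess of the quotient over
-- the size.
divide-excess : ∀ p q {r} → 0ℚ < r → ∃[ e ] (p + e) * r ≡ q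
divide-excess p q {r} 0<r = q * 1/ r - p , trans (identity p q r (1/ r))
  (trans (cong (q *_) (*-inverseˡ r)) (*-identityʳ q))
  where
  instance
    r≢0 = pos⇒nonZero r {{positive 0<r}}
  identity : ∀ p q r s → (p + (q * s - p)) * r ≡ q * (s * r)
  identity = solve-∀ ℚ-ring

sum-split : ∀ {n} (b : Fin n → Bool) (w : Vector ℚ n) →
  sum (λ i → ⟦ b i ⟧ * w i * (⟦ b i ⟧ * w i)) + sum (λ i → ⟦ not (b i) ⟧ * w i * (⟦ not (b i) ⟧ * w i))
  ≡ sum (λ i → w i * w i)
sum-split b w = trans
  (sym (∑-distrib-+ (λ i → ⟦ b i ⟧ * w i * (⟦ b i ⟧ * w i)) (λ i → ⟦ not (b i) ⟧ * w i * (⟦ not (b i) ⟧ * w i))))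
  (sum-cong-≗ (λ i → split (b i) (w i)))
  where
  split-true : ∀ w → 1ℚ * w * (1ℚ * w) + 0ℚ * w * (0ℚ * w) ≡ w * w
  split-true = solve-∀ ℚ-ring
  split-false : ∀ w → 0ℚ * w * (0ℚ * w) + 1ℚ * w * (1ℚ * w) ≡ w * w
  split-false = solve-∀ ℚ-ring
  split : ∀ a w → ⟦ a ⟧ * w * (⟦ a ⟧ * w) + ⟦ not a ⟧ * w * (⟦ not a ⟧ * w) ≡ w * w
  split true  = split-true
  split false = split-false

-- Indexing by a Boolean lets a single decision supply both the 0/1 entry and the direction of the
-- inequality.
Ordered : Bool → ℚ → ℚ → Set
Ordered true  p q = p ≤ q
Ordered false p q = q ≤ p

ordered : ∀ {p q} (p≤?q : Dec (p ≤ q)) → Ordered (does p≤?q) p q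
ordered (yes p≤q) = p≤q
ordered (no  p≰q) = <⇒≤ (≰⇒> p≰q)

-- Multiply the two inequalities and cancel the squares.
geometric-mean-mono : ∀ {p q} {x x′ y y′} → 0ℚ ≤ q → 0ℚ ≤ x → 0ℚ ≤ x′ →
  0ℚ ≤ p → p * (y * y) ≤ q * (x * x) → p * (y′ * y′) ≤ q * (x′ * x′) →
  p * (y * y′) ≤ q * (x * x′)
geometric-mean-mono {p} {q} {x} {x′} {y} {y′} 0≤q 0≤x 0≤x′ 0≤p py²≤qx² py′²≤qx′² =
  square-cancel-≤ (0≤* 0≤q (0≤* 0≤x 0≤x′)) (subst₂ _≤_ (regroup p y y′) (regroup q x x′)
    (*-mono (0≤* 0≤p (0≤p*p y)) (0≤* 0≤q (0≤p*p x′)) py²≤qx² py′²≤qx′²))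
  where
  regroup : ∀ p y y′ → p * (y * y) * (p * (y′ * y′)) ≡ p * (y * y′) * (p * (y * y′))
  regroup = solve-∀ ℚ-ring

module _ {P Q} (0≤P : 0ℚ ≤ P) (0≤Q : 0ℚ ≤ Q) where

  -- Here a and a′ say on which side of the partition the two indices lie. All cases are equalities
  -- except a non-edge inside C and an edge inside the complement, where one product is exchanged
  -- for a larger one.
  block-term-bound : ∀ a a′ {ε ε′} → ε ≡ ε′ → ∀ {x x′ y y′} →
    0ℚ ≤ x → 0ℚ ≤ x′ → 0ℚ ≤ y → 0ℚ ≤ y′ →
    Ordered a (P * (y * y)) (Q * (x * x)) → Ordered a′ (P * (y′ * y′)) (Q * (x′ * x′)) →
    Q * (⟦ ε ⟧ * (x * x′)) + P * (⟦ not ε ⟧ * (y * y′)) ≤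
    Q * (1ℚ * (⟦ a ⟧ * x * (⟦ a′ ⟧ * x′))
      + 1ℚ * (⟦ a ⟧ * x * (⟦ a ∧ ε ∧ not a′ ⟧ * (⟦ not a′ ⟧ * x′))
            + ⟦ a′ ⟧ * x′ * (⟦ a′ ∧ ε′ ∧ not a ⟧ * (⟦ not a ⟧ * x))))
    + P * (1ℚ * (⟦ not a ⟧ * y * (⟦ not a′ ⟧ * y′))
      + 1ℚ * (⟦ not a ⟧ * y * (⟦ not a ∧ not ε ∧ a′ ⟧ * (⟦ a′ ⟧ * y′))
            + ⟦ not a′ ⟧ * y′ * (⟦ not a′ ∧ not ε′ ∧ a ⟧ * (⟦ a ⟧ * y))))
  block-term-bound true true {true} refl {x} {x′} {y} {y′} _ _ _ _ _ _ =
    ≤-reflexive (identity P Q x x′ y y′)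
    where
    identity : ∀ P Q x x′ y y′ → Q * (1ℚ * (x * x′)) + P * (0ℚ * (y * y′)) ≡
      Q * (1ℚ * (1ℚ * x * (1ℚ * x′)) + 1ℚ * (1ℚ * x * (0ℚ * (0ℚ * x′)) + 1ℚ * x′ * (0ℚ * (0ℚ * x))))
      + P * (1ℚ * (0ℚ * y * (0ℚ * y′)) + 1ℚ * (0ℚ * y * (0ℚ * (1ℚ * y′)) + 0ℚ * y′ * (0ℚ * (1ℚ * y))))
    identity = solve-∀ ℚ-ring
  block-term-bound true true {false} refl {x} {x′} {y} {y′} 0≤x 0≤x′ 0≤y 0≤y′ y≤x y′≤x′ =
    ≤-by (p≤q⇒0≤q-p (geometric-mean-mono {y = y} {y′} 0≤Q 0≤x 0≤x′ 0≤P y≤x y′≤x′)) (identity P Q x x′ y y′)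
    where
    identity : ∀ P Q x x′ y y′ →
      Q * (1ℚ * (1ℚ * x * (1ℚ * x′)) + 1ℚ * (1ℚ * x * (0ℚ * (0ℚ * x′)) + 1ℚ * x′ * (0ℚ * (0ℚ * x))))
      + P * (1ℚ * (0ℚ * y * (0ℚ * y′)) + 1ℚ * (0ℚ * y * (0ℚ * (1ℚ * y′)) + 0ℚ * y′ * (0ℚ * (1ℚ * y))))
      ≡ Q * (0ℚ * (x * x′)) + P * (1ℚ * (y * y′)) + (Q * (x * x′) - P * (y * y′))
    identity = solve-∀ ℚ-ring
  block-term-bound false false {false} refl {x} {x′} {y} {y′} _ _ _ _ _ _ =
    ≤-reflexive (identity P Q x x′ y y′)
    where
    identity : ∀ P Q x x′ y y′ → Q * (0ℚ * (x * x′)) + P * (1ℚ * (y * y′)) ≡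
      Q * (1ℚ * (0ℚ * x * (0ℚ * x′)) + 1ℚ * (0ℚ * x * (0ℚ * (1ℚ * x′)) + 0ℚ * x′ * (0ℚ * (1ℚ * x))))
      + P * (1ℚ * (1ℚ * y * (1ℚ * y′)) + 1ℚ * (1ℚ * y * (0ℚ * (0ℚ * y′)) + 1ℚ * y′ * (0ℚ * (0ℚ * y))))
    identity = solve-∀ ℚ-ring
  block-term-bound false false {true} refl {x} {x′} {y} {y′} 0≤x 0≤x′ 0≤y 0≤y′ x≤y x′≤y′ =
    ≤-by (p≤q⇒0≤q-p (geometric-mean-mono {y = x} {x′} 0≤P 0≤y 0≤y′ 0≤Q x≤y x′≤y′)) (identity P Q x x′ y y′)
    where
    identity : ∀ P Q x x′ y y′ →
      Q * (1ℚ * (0ℚ * x * (0ℚ * x′)) + 1ℚ * (0ℚ * x * (0ℚ * (1ℚ * x′)) + 0ℚ * x′ * (0ℚ * (1ℚ * x))))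
      + P * (1ℚ * (1ℚ * y * (1ℚ * y′)) + 1ℚ * (1ℚ * y * (0ℚ * (0ℚ * y′)) + 1ℚ * y′ * (0ℚ * (0ℚ * y))))
      ≡ Q * (1ℚ * (x * x′)) + P * (0ℚ * (y * y′)) + (P * (y * y′) - Q * (x * x′))
    identity = solve-∀ ℚ-ring
  block-term-bound true false {true} refl {x} {x′} {y} {y′} _ _ _ _ _ _ =
    ≤-reflexive (identity P Q x x′ y y′)
    where
    identity : ∀ P Q x x′ y y′ → Q * (1ℚ * (x * x′)) + P * (0ℚ * (y * y′)) ≡
      Q * (1ℚ * (1ℚ * x * (0ℚ * x′)) + 1ℚ * (1ℚ * x * (1ℚ * (1ℚ * x′)) + 0ℚ * x′ * (0ℚ * (0ℚ * x))))
      + P * (1ℚ * (0ℚ * y * (1ℚ * y′)) + 1ℚ * (0ℚ * y * (0ℚ * (0ℚ * y′)) + 1ℚ * y′ * (0ℚ * (1ℚ * y))))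
    identity = solve-∀ ℚ-ring
  block-term-bound true false {false} refl {x} {x′} {y} {y′} _ _ _ _ _ _ =
    ≤-reflexive (identity P Q x x′ y y′)
    where
    identity : ∀ P Q x x′ y y′ → Q * (0ℚ * (x * x′)) + P * (1ℚ * (y * y′)) ≡
      Q * (1ℚ * (1ℚ * x * (0ℚ * x′)) + 1ℚ * (1ℚ * x * (0ℚ * (1ℚ * x′)) + 0ℚ * x′ * (0ℚ * (0ℚ * x))))
      + P * (1ℚ * (0ℚ * y * (1ℚ * y′)) + 1ℚ * (0ℚ * y * (0ℚ * (0ℚ * y′)) + 1ℚ * y′ * (1ℚ * (1ℚ * y))))
    identity = solve-∀ ℚ-ring
  block-term-bound false true {true} refl {x} {x′} {y} {y′} _ _ _ _ _ _ =
    ≤-reflexive (identity P Q x x′ y y′)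
    where
    identity : ∀ P Q x x′ y y′ → Q * (1ℚ * (x * x′)) + P * (0ℚ * (y * y′)) ≡
      Q * (1ℚ * (0ℚ * x * (1ℚ * x′)) + 1ℚ * (0ℚ * x * (0ℚ * (0ℚ * x′)) + 1ℚ * x′ * (1ℚ * (1ℚ * x))))
      + P * (1ℚ * (1ℚ * y * (0ℚ * y′)) + 1ℚ * (1ℚ * y * (0ℚ * (1ℚ * y′)) + 0ℚ * y′ * (0ℚ * (0ℚ * y))))
    identity = solve-∀ ℚ-ring
  block-term-bound false true {false} refl {x} {x′} {y} {y′} _ _ _ _ _ _ =
    ≤-reflexive (identity P Q x x′ y y′)
    where
    identity : ∀ P Q x x′ y y′ → Q * (0ℚ * (x * x′)) + P * (1ℚ * (y * y′)) ≡
      Q * (1ℚ * (0ℚ * x * (1ℚ * x′)) + 1ℚ * (0ℚ * x * (0ℚ * (0ℚ * x′)) + 1ℚ * x′ * (0ℚ * (1ℚ * x))))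
      + P * (1ℚ * (1ℚ * y * (0ℚ * y′)) + 1ℚ * (1ℚ * y * (1ℚ * (1ℚ * y′)) + 0ℚ * y′ * (0ℚ * (0ℚ * y))))
    identity = solve-∀ ℚ-ring

-- The block between the two classes of a partition

module _ {n} (adj : Fin n → Fin n → Bool) (adj-sym : ∀ i j → adj i j ≡ adj j i)
  (b : Fin n → Bool) where

  private
    χ ψ : Vector ℚ n
    χ i = ⟦ b i ⟧
    ψ i = ⟦ not (b i) ⟧

    -- `m` is the block M with rows in C. `m′` is the transpose of J - M, with rows in the
    -- complement, so that the lemmas on blocks apply to it with ψ in place of χ.
    m m′ : Fin n → Vector ℚ n
    m  i j = ⟦ b i ∧ adj i j ∧ not (b j) ⟧
    m′ i j = ⟦ not (b i) ∧ not (adj i j) ∧ b j ⟧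

    c = sum χ
    d = sum ψ
    S = sum (λ i → sum (m i))

    row : Vector ℚ n
    row i = sum (m i)

    κ = sum (λ j → sum (λ i → m i j) * sum (λ i → m i j))
    κ′ = sum (λ j → sum (λ i → m′ i j) * sum (λ i → m′ i j))

    χ-idem : ∀ i → χ i * χ i ≡ χ i
    χ-idem i = ⟦⟧-idem (b i)

    ψ-idem : ∀ i → ψ i * ψ i ≡ ψ i
    ψ-idem i = ⟦⟧-idem (not (b i))

    m-idem : ∀ i j → m i j * m i j ≡ m i j
    m-idem i j = ⟦⟧-idem (b i ∧ adj i j ∧ not (b j))

    m′-idem : ∀ i j → m′ i j * m′ i j ≡ m′ i j
    m′-idem i j = ⟦⟧-idem (not (b i) ∧ not (adj i j) ∧ b j)

    ⟦⟧-∧ : ∀ a a′ → ⟦ a ⟧ * ⟦ a ∧ a′ ⟧ ≡ ⟦ a ∧ a′ ⟧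
    ⟦⟧-∧ true  a′ = *-identityˡ ⟦ a′ ⟧
    ⟦⟧-∧ false a′ = refl

    χm≡m : ∀ i j → χ i * m i j ≡ m i j
    χm≡m i j = ⟦⟧-∧ (b i) (adj i j ∧ not (b j))

    ψm′≡m′ : ∀ i j → ψ i * m′ i j ≡ m′ i j
    ψm′≡m′ i j = ⟦⟧-∧ (not (b i)) (not (adj i j) ∧ b j)

    mψ≡m : ∀ i j → m i j * ψ j ≡ m i j
    mψ≡m i j = cases (b i) (adj i j) (b j)
      where
      cases : ∀ a e a′ → ⟦ a ∧ e ∧ not a′ ⟧ * ⟦ not a′ ⟧ ≡ ⟦ a ∧ e ∧ not a′ ⟧
      cases true  true  true  = refl
      cases true  true  false = refl
      cases true  false true  = refl
      cases true  false false = refl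
      cases false _     true  = refl
      cases false _     false = refl

    m′≡ψχ-mᵀ : ∀ i j → m′ i j ≡ χ j * ψ i + - 1ℚ * m j i
    m′≡ψχ-mᵀ i j rewrite adj-sym j i = cases (b i) (adj i j) (b j)
      where
      cases : ∀ a e a′ → ⟦ not a ∧ not e ∧ a′ ⟧ ≡ ⟦ a′ ⟧ * ⟦ not a ⟧ + - 1ℚ * ⟦ a′ ∧ e ∧ not a ⟧
      cases true  true  true  = refl
      cases true  true  false = refl
      cases true  false true  = refl
      cases true  false false = refl
      cases false true  true  = refl
      cases false true  false = refl
      cases false false true  = refl
      cases false false false = refl

    -- By the symmetry of `adj`, columns of `m′` are complemented rows of `m`; this expresses κ′
    -- through the row sums of M.
    col′ : ∀ j → sum (λ i → m′ i j) ≡ d * χ j + - 1ℚ * row j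
    col′ j = trans (sum-cong-≗ (λ i → m′≡ψχ-mᵀ i j))
      (trans (sum-linear (χ j) (- 1ℚ) ψ (m j)) (cong (_+ - 1ℚ * row j) (*-comm (χ j) d)))

    S′≡cd-S : sum (λ i → sum (m′ i)) ≡ c * d - S
    S′≡cd-S = trans (∑-comm m′) (trans (sum-cong-≗ col′)
      (trans (sum-linear d (- 1ℚ) χ row) (identity c d S)))
      where
      identity : ∀ c d S → d * c + - 1ℚ * S ≡ c * d - S
      identity = solve-∀ ℚ-ring

    0≤S : 0ℚ ≤ S
    0≤S = 0≤sum (λ i → 0≤sum (λ j → 0≤⟦⟧ (b i ∧ adj i j ∧ not (b j))))

    0≤cd-S : 0ℚ ≤ c * d - S
    0≤cd-S = subst (0ℚ ≤_) S′≡cd-S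
      (0≤sum (λ i → 0≤sum (λ j → 0≤⟦⟧ (not (b i) ∧ not (adj i j) ∧ b j))))

    χrow≡row : ∀ i → χ i * row i ≡ row i
    χrow≡row i = trans (*-distribˡ-sum (χ i) (m i)) (sum-cong-≗ (χm≡m i))

    κ′≡ : κ′ ≡ d * (d * c) - (d + d) * S + sum (λ i → row i * row i)
    κ′≡ = trans (sum-cong-≗ (λ j → trans (cong (λ x → x * x) (col′ j))
        (trans (expand d (χ j) (row j))
          (cong₂ (λ p q → 1ℚ * (d * d * p + - (d + d) * q) + 1ℚ * (row j * row j)) (χ-idem j) (χrow≡row j)))))
      (trans (sum-linear 1ℚ 1ℚ (λ j → d * d * χ j + - (d + d) * row j) (λ j → row j * row j))
        (trans (cong (λ s → 1ℚ * s + 1ℚ * sum (λ j → row j * row j)) (sum-linear (d * d) (- (d + d)) χ row))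
          (collect c d S (sum (λ j → row j * row j)))))
      where
      expand : ∀ d x r → (d * x + - 1ℚ * r) * (d * x + - 1ℚ * r)
        ≡ 1ℚ * (d * d * (x * x) + - (d + d) * (x * r)) + 1ℚ * (r * r)
      expand = solve-∀ ℚ-ring
      collect : ∀ c d S ρ → 1ℚ * (d * d * c + - (d + d) * S) + 1ℚ * ρ ≡ d * (d * c) - (d + d) * S + ρ
      collect = solve-∀ ℚ-ring

    -- After substituting `κ′≡`, this is a rearrangement of `row-variance`, with d as the squared
    -- norm of ψ.
    variances : 0ℚ < c → d * κ + c * κ′ ≤ c * d * (c * d - S) + S * S
    variances 0<c = ≤-by
      (p≤q⇒0≤q-p (row-variance χ m χ-idem m-idem χm≡m 0<c ψ mψ≡m))
      (trans (identity c d S κ (sum (λ i → row i * row i)))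
        (cong₂ (λ k δ → d * κ + c * k + (δ * (c * S - κ) - (c * sum (λ i → row i * row i) - S * S)))
          (sym κ′≡) (sym (sum-cong-≗ ψ-idem))))
      where
      identity : ∀ c d S κ ρ → c * d * (c * d - S) + S * S ≡
        d * κ + c * (d * (d * c) - (d + d) * S + ρ) + (d * (c * S - κ) - (c * ρ - S * S))
      identity = solve-∀ ℚ-ring

  module _ (u z u′ z′ : Vector ℚ n)
    (χu≡u : ∀ i → χ i * u i ≡ u i) (ψu′≡u′ : ∀ i → ψ i * u′ i ≡ u′ i)
    (0<P : 0ℚ < sum (λ i → u i * u i) + sum (λ i → z i * z i))
    (0<Q : 0ℚ < sum (λ i → u′ i * u′ i) + sum (λ i → z′ i * z′ i))
    {e e′ h} (0≤h : 0ℚ ≤ h) (c+d≡3h : c + d ≡ h + h + h)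
    (rayleigh : (c + e) * (sum (λ i → u i * u i) + sum (λ i → z i * z i)) ≤ sum u * sum u
      + (sum (λ i → u i * sum (λ j → m i j * z j)) + sum (λ i → u i * sum (λ j → m i j * z j))))
    (rayleigh′ : (d + e′) * (sum (λ i → u′ i * u′ i) + sum (λ i → z′ i * z′ i)) ≤ sum u′ * sum u′
      + (sum (λ i → u′ i * sum (λ j → m′ i j * z′ j)) + sum (λ i → u′ i * sum (λ j → m′ i j * z′ j))))
    where

    private
      d≡ : d ≡ h + h + h - c
      d≡ = trans (identity c d) (cong (_- c) c+d≡3h)
        where
        identity : ∀ c d → d ≡ c + d - c
        identity = solve-∀ ℚ-ring
      c≡ : c ≡ h + h + h - d
      c≡ = trans (identity c d) (cong (_- d) c+d≡3h)
        where
        identity : ∀ c d → c ≡ c + d - d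
        identity = solve-∀ ℚ-ring

      0<c : 0ℚ < e → 0ℚ < c
      0<c 0<e = 0<size χ m χ-idem m-idem χm≡m u z χu≡u 0<e 0<P rayleigh

      0<d : 0ℚ < e′ → 0ℚ < d
      0<d 0<e′ = 0<size ψ m′ ψ-idem m′-idem ψm′≡m′ u′ z′ ψu′≡u′ 0<e′ 0<Q rayleigh′

      cubic : 0ℚ < e → (c + e) * (c + e) * e ≤ S * e + κ
      cubic 0<e = eigenvalue-cubic χ m χ-idem m-idem χm≡m u z χu≡u 0<e 0<P rayleigh

      cubic′ : 0ℚ < e′ → (d + e′) * (d + e′) * e′ ≤ (c * d - S) * e′ + κ′
      cubic′ 0<e′ = subst (λ s → (d + e′) * (d + e′) * e′ ≤ s * e′ + κ′) S′≡cd-S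
        (eigenvalue-cubic ψ m′ ψ-idem m′-idem ψm′≡m′ u′ z′ ψu′≡u′ 0<e′ 0<Q rayleigh′)

      quadratic : 0ℚ < e → (c + e) * e ≤ S
      quadratic 0<e = eigenvalue-quadratic χ m χ-idem m-idem χm≡m u z χu≡u 0<e 0<P rayleigh

      quadratic′ : 0ℚ < e′ → (d + e′) * e′ ≤ c * d - S
      quadratic′ 0<e′ = subst ((d + e′) * e′ ≤_) S′≡cd-S
        (eigenvalue-quadratic ψ m′ ψ-idem m′-idem ψm′≡m′ u′ z′ ψu′≡u′ 0<e′ 0<Q rayleigh′)

    -- The combined estimate applies when both excesses are positive. If only one is, its quadratic
    -- inequality suffices.
    excess-bound : e + e′ ≤ h
    excess-bound with 0ℚ <? e | 0ℚ <? e′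
    ... | no e≯0  | no e′≯0  = ≤-trans (+-mono-≤ (≮⇒≥ e≯0) (≮⇒≥ e′≯0)) 0≤h
    ... | no e≯0  | yes 0<e′ =
      one-sided-bound d d≡ (<⇒≤ (0<d 0<e′)) 0≤h 0≤S (≮⇒≥ e≯0) (quadratic′ 0<e′)
    -- The same bound with the classes exchanged and cd - S in the role of S.
    ... | yes 0<e | no e′≯0  = subst (_≤ h) (+-comm e′ e)
      (one-sided-bound c c≡ (<⇒≤ (0<c 0<e)) 0≤h 0≤cd-S (≮⇒≥ e′≯0)
        (subst ((c + e) * e ≤_) (identity c d S) (quadratic 0<e)))
      where
      identity : ∀ c d S → S ≡ d * c - (c * d - S)
      identity = solve-∀ ℚ-ring
    ... | yes 0<e | yes 0<e′ =
      eigenvalue-bound d d≡ (0<c 0<e) (0<d 0<e′) 0<h 0<e 0<e′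
        (cubic 0<e) (cubic′ 0<e′) (quadratic 0<e) (quadratic′ 0<e′) (variances (0<c 0<e))
      where
      0<h : 0ℚ < h
      0<h = 0<p*q⇒0<q (<⇒≤ 0<3)
        (subst (0ℚ <_) (trans c+d≡3h (triple h)) (0<+ (0<c 0<e) (<⇒≤ (0<d 0<e′))))

-- The double sum is the form of the matrix with ones on the first class, M and its transpose off
-- the diagonal, and zeros on the second class. Both mixed terms are kept, so that it can be
-- compared with a symmetric form entry by entry.
sum-symmetrised : ∀ {n} (m : Fin n → Vector ℚ n) (u z : Vector ℚ n) →
  sum (λ i → sum (λ j → 1ℚ * (u i * u j) + 1ℚ * (u i * (m i j * z j) + u j * (m j i * z i))))
  ≡ sum u * sum u + (sum (λ i → u i * sum (λ j → m i j * z j)) + sum (λ i → u i * sum (λ j → m i j * z j)))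
sum-symmetrised {n} m u z = begin
  sum (λ i → sum (λ j → 1ℚ * (u i * u j) + 1ℚ * (a i j + a j i)))
    ≡⟨ sum-cong-≗ (λ i → sum-linear 1ℚ 1ℚ (λ j → u i * u j) (λ j → a i j + a j i)) ⟩
  sum (λ i → 1ℚ * sum (λ j → u i * u j) + 1ℚ * sum (λ j → a i j + a j i))
    ≡⟨ sum-linear 1ℚ 1ℚ (λ i → sum (λ j → u i * u j)) (λ i → sum (λ j → a i j + a j i)) ⟩
  1ℚ * sum (λ i → sum (λ j → u i * u j)) + 1ℚ * sum (λ i → sum (λ j → a i j + a j i))
    ≡⟨ cong₂ (λ p q → 1ℚ * p + 1ℚ * q) Σuu ΣΣa ⟩
  1ℚ * (sum u * sum u) + 1ℚ * (W + W)
    ≡⟨ cong₂ _+_ (*-identityˡ (sum u * sum u)) (*-identityˡ (W + W)) ⟩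
  sum u * sum u + (W + W) ∎
  where
  open ≡-Reasoning
  a : Fin n → Vector ℚ n
  a i j = u i * (m i j * z j)
  W = sum (λ i → u i * sum (λ j → m i j * z j))
  Σuu : sum (λ i → sum (λ j → u i * u j)) ≡ sum u * sum u
  Σuu = trans (sum-cong-≗ (λ i → sym (*-distribˡ-sum (u i) u))) (sym (*-distribʳ-sum (sum u) u))
  Σa : sum (λ i → sum (a i)) ≡ W
  Σa = sum-cong-≗ (λ i → sym (*-distribˡ-sum (u i) (λ j → m i j * z j)))
  ΣΣa : sum (λ i → sum (λ j → a i j + a j i)) ≡ W + W
  ΣΣa = trans (sum-cong-≗ (λ i → ∑-distrib-+ (a i) (λ j → a j i)))
    (trans (∑-distrib-+ (λ i → sum (a i)) (λ i → sum (λ j → a j i)))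
      (cong₂ _+_ Σa (trans (∑-comm (λ i j → a j i)) Σa)))

-- The inequality for unit vectors in homogeneous form: normalising would require square roots. Here
-- h = n/3.
quadratic-forms-bound : ∀ {n} (adj : Fin n → Fin n → Bool) → (∀ i j → adj i j ≡ adj j i) →
  ∀ {x y : Vector ℚ n} → (∀ i → 0ℚ ≤ x i) → (∀ i → 0ℚ ≤ y i) →
  ∀ {h} → sum-ones n ≡ h + h + h →
  0ℚ < sum (λ i → x i * x i) → 0ℚ < sum (λ i → y i * y i) →
  sum (λ i → y i * y i) * quadratic-form (λ i j → ⟦ adj i j ⟧) x
  + sum (λ i → x i * x i) * quadratic-form (λ i j → ⟦ not (adj i j) ⟧) y
  ≤ (h + h + h + h) * (sum (λ i → x i * x i) * sum (λ i → y i * y i))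
quadratic-forms-bound {n} adj adj-sym {x} {y} 0≤x 0≤y {h} n≡3h 0<P 0<Q = begin
  Q * quadratic-form (λ i j → ⟦ adj i j ⟧) x + P * quadratic-form (λ i j → ⟦ not (adj i j) ⟧) y
    ≡⟨ trans
         (sum-cong-≗ (λ i → sum-linear Q P
           (λ j → ⟦ adj i j ⟧ * (x i * x j)) (λ j → ⟦ not (adj i j) ⟧ * (y i * y j))))
         (sum-linear Q P
           (λ i → sum (λ j → ⟦ adj i j ⟧ * (x i * x j)))
           (λ i → sum (λ j → ⟦ not (adj i j) ⟧ * (y i * y j)))) ⟨
  sum (λ i → sum (λ j → Q * (⟦ adj i j ⟧ * (x i * x j)) + P * (⟦ not (adj i j) ⟧ * (y i * y j))))
    ≤⟨ sum-mono-≤ (λ i → sum-mono-≤ (λ j → termwise i j)) ⟩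
  sum (λ i → sum (λ j → Q * block m u z i j + P * block m′ u′ z′ i j))
    ≡⟨ trans (sum-cong-≗ (λ i → sum-linear Q P (block m u z i) (block m′ u′ z′ i)))
         (sum-linear Q P (λ i → sum (block m u z i)) (λ i → sum (block m′ u′ z′ i))) ⟩
  Q * sum (λ i → sum (block m u z i)) + P * sum (λ i → sum (block m′ u′ z′ i))
    ≡⟨ cong₂ (λ p q → Q * p + P * q)
         (trans (sum-symmetrised m u z) (sym eigenvalue≡)) (trans (sum-symmetrised m′ u′ z′) (sym eigenvalue′≡)) ⟩
  Q * ((c + e) * P) + P * ((d + e′) * Q)
    ≡⟨ factor c d e e′ P Q ⟩
  (c + d + (e + e′)) * (P * Q)
    ≤⟨ *-monoʳ-≤-nonNeg (P * Q) {{nonNegative (0≤* (<⇒≤ 0<P) (<⇒≤ 0<Q))}}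
         (+-mono-≤ (≤-reflexive c+d≡3h) e+e′≤h) ⟩
  (h + h + h + h) * (P * Q) ∎
  where
  open ≤-Reasoning
  P = sum (λ i → x i * x i)
  Q = sum (λ i → y i * y i)

  -- This is the comparison of the normalised entries of x and y, squared and cleared of
  -- denominators.
  b : Fin n → Bool
  b i = does (P * (y i * y i) ≤? Q * (x i * x i))

  -- x splits into u on C and z off C; for y the roles of the classes are exchanged.
  χ ψ u z u′ z′ : Vector ℚ n
  χ i = ⟦ b i ⟧
  ψ i = ⟦ not (b i) ⟧
  u i = χ i * x i
  z i = ψ i * x i
  u′ i = ψ i * y i
  z′ i = χ i * y i
  c = sum χ
  d = sum ψ

  m m′ : Fin n → Vector ℚ n
  m  i j = ⟦ b i ∧ adj i j ∧ not (b j) ⟧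
  m′ i j = ⟦ not (b i) ∧ not (adj i j) ∧ b j ⟧

  block : (Fin n → Vector ℚ n) → Vector ℚ n → Vector ℚ n → Fin n → Vector ℚ n
  block m u z i j = 1ℚ * (u i * u j) + 1ℚ * (u i * (m i j * z j) + u j * (m j i * z i))

  total : (Fin n → Vector ℚ n) → Vector ℚ n → Vector ℚ n → ℚ
  total m u z = sum u * sum u
    + (sum (λ i → u i * sum (λ j → m i j * z j)) + sum (λ i → u i * sum (λ j → m i j * z j)))

  factor : ∀ c d e e′ P Q → Q * ((c + e) * P) + P * ((d + e′) * Q) ≡ (c + d + (e + e′)) * (P * Q)
  factor = solve-∀ ℚ-ring

  c+d≡3h : c + d ≡ h + h + h
  c+d≡3h = trans (sym (∑-distrib-+ χ ψ)) (trans (sum-cong-≗ (λ i → ⟦⟧-complement (b i))) n≡3h)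

  -- The excesses are those of the enlarged forms, not of the original ones.
  e = proj₁ (divide-excess c (total m u z) 0<P)
  e′ = proj₁ (divide-excess d (total m′ u′ z′) 0<Q)

  eigenvalue≡ : (c + e) * P ≡ total m u z
  eigenvalue≡ = proj₂ (divide-excess c (total m u z) 0<P)

  eigenvalue′≡ : (d + e′) * Q ≡ total m′ u′ z′
  eigenvalue′≡ = proj₂ (divide-excess d (total m′ u′ z′) 0<Q)

  P≡ : sum (λ i → u i * u i) + sum (λ i → z i * z i) ≡ P
  P≡ = sum-split b x

  Q≡ : sum (λ i → u′ i * u′ i) + sum (λ i → z′ i * z′ i) ≡ Q
  Q≡ = trans (+-comm (sum (λ i → u′ i * u′ i)) (sum (λ i → z′ i * z′ i))) (sum-split b y)

  ⟦⟧-absorb : ∀ a w → ⟦ a ⟧ * (⟦ a ⟧ * w) ≡ ⟦ a ⟧ * w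
  ⟦⟧-absorb a w = trans (sym (*-assoc ⟦ a ⟧ ⟦ a ⟧ w)) (cong (_* w) (⟦⟧-idem a))

  0≤h : 0ℚ ≤ h
  0≤h = 0≤p*q⇒0≤q 0<3 (subst (0ℚ ≤_) (trans n≡3h (triple h))
    (0≤sum {n} {λ _ → 1ℚ} (λ _ → 0≤⟦⟧ true)))

  e+e′≤h : e + e′ ≤ h
  e+e′≤h = excess-bound adj adj-sym b u z u′ z′
    (λ i → ⟦⟧-absorb (b i) (x i)) (λ i → ⟦⟧-absorb (not (b i)) (y i))
    (subst (0ℚ <_) (sym P≡) 0<P) (subst (0ℚ <_) (sym Q≡) 0<Q) 0≤h c+d≡3h
    (≤-reflexive (trans (cong ((c + e) *_) P≡) eigenvalue≡))
    (≤-reflexive (trans (cong ((d + e′) *_) Q≡) eigenvalue′≡))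

  termwise : ∀ i j → Q * (⟦ adj i j ⟧ * (x i * x j)) + P * (⟦ not (adj i j) ⟧ * (y i * y j))
    ≤ Q * block m u z i j + P * block m′ u′ z′ i j
  termwise i j = block-term-bound (<⇒≤ 0<P) (<⇒≤ 0<Q) (b i) (b j) (adj-sym i j)
    (0≤x i) (0≤x j) (0≤y i) (0≤y j)
    (ordered (P * (y i * y i) ≤? Q * (x i * x i))) (ordered (P * (y j * y j) ≤? Q * (x j * x j)))

-- Graphs and approximate eigenvectors

-- `+ n / 1` is normalised by a gcd that does not reduce for variable n, so the addition is done on
-- unnormalised rationals.
sum-ones≡n/1 : ∀ n → sum-ones n ≡ + n / 1
sum-ones≡n/1 zero    = refl
sum-ones≡n/1 (suc n) = trans (cong (λ p → 1ℚ + p) (sum-ones≡n/1 n)) (toℚᵘ-injective (begin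
  toℚᵘ (1ℚ + + n / 1)
    ≈⟨ toℚᵘ-homo-+ 1ℚ (+ n / 1) ⟩
  toℚᵘ 1ℚ ℚᵘ.+ toℚᵘ (+ n / 1)
    ≈⟨ ℚᵘ.+-congʳ (toℚᵘ 1ℚ) (toℚᵘ-fromℚᵘ (ℚᵘ.mkℚᵘ (+ n) 0)) ⟩
  toℚᵘ 1ℚ ℚᵘ.+ ℚᵘ.mkℚᵘ (+ n) 0
    ≈⟨ ℚᵘ.*≡* (identity (+ n)) ⟩
  ℚᵘ.mkℚᵘ (+ suc n) 0
    ≈⟨ toℚᵘ-fromℚᵘ (ℚᵘ.mkℚᵘ (+ suc n) 0) ⟨
  toℚᵘ (+ suc n / 1) ∎))
  where
  open ℚᵘ.≃-Reasoning
  identity : ∀ k → (ℤ.1ℤ ℤ.* ℤ.1ℤ ℤ.+ k ℤ.* ℤ.1ℤ) ℤ.* ℤ.1ℤ ≡ (ℤ.1ℤ ℤ.+ k) ℤ.* (ℤ.1ℤ ℤ.* ℤ.1ℤ)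
  identity = ℤ-Solver.solve-∀

sum-select : ∀ {n} (i : Fin n) (g : Vector ℚ n) → sum (λ j → ⟦ does (i Fin.≟ j) ⟧ * g j) ≡ g i
sum-select {suc n} zero g = trans (cong₂ _+_ (*-identityˡ (g zero))
  (trans (sum-cong-≗ (λ j → *-zeroˡ (g (suc j)))) (sum-replicate-zero n))) (+-identityʳ (g zero))
sum-select (suc i) g = trans (cong₂ _+_ (*-zeroˡ (g zero)) (sum-select i (g ∘ suc))) (+-identityˡ (g (suc i)))

p≤∣p∣ : ∀ p → p ≤ ∣ p ∣
p≤∣p∣ p = ≮⇒≥ λ ∣p∣<p → <-irrefl (0≤p⇒∣p∣≡p (≤-trans (0≤∣p∣ p) (<⇒≤ ∣p∣<p))) ∣p∣<p

∣p∣*∣p∣≡p*p : ∀ p → ∣ p ∣ * ∣ p ∣ ≡ p * p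
∣p∣*∣p∣≡p*p p = trans (sym (∣p*q∣≡∣p∣*∣q∣ p p)) (0≤p⇒∣p∣≡p (0≤p*p p))

-- This takes the place of a nonnegative Perron vector: absolute values keep the norm and do not
-- lower the form.
quadratic-form-∣∣ : ∀ {n} (m : Fin n → Vector ℚ n) → (∀ i j → 0ℚ ≤ m i j) → ∀ x →
  quadratic-form m x ≤ quadratic-form m (λ i → ∣ x i ∣)
quadratic-form-∣∣ m 0≤m x = sum-mono-≤ λ i → sum-mono-≤ λ j →
  *-monoˡ-≤-nonNeg (m i j) {{nonNegative (0≤m i j)}}
    (subst (x i * x j ≤_) (∣p*q∣≡∣p∣*∣q∣ (x i) (x j)) (p≤∣p∣ (x i * x j)))

module _ {n} (G : SimpleGraph n) where

  edge : Fin n → Fin n → Bool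
  edge i j = does (adj? G i j)

  edge-sym : ∀ i j → edge i j ≡ edge j i
  edge-sym i j = does-⇔ (mk⇔ (symm G) (symm G)) (adj? G i j) (adj? G j i)

  -- The matrix identity Ā + I = J - A as an identity of quadratic forms; the norm of y is the
  -- source of the -1.
  complement-form : ∀ y →
    quadratic-form (λ i j → ⟦ does (adj? (complement G) i j) ⟧) y + sum (λ i → y i * y i)
    ≡ quadratic-form (λ i j → ⟦ not (edge i j) ⟧) y
  complement-form y = trans
    (cong (λ s → quadratic-form (λ i j → ⟦ does (adj? (complement G) i j) ⟧) y + s)
      (sum-cong-≗ (λ i → sym (sum-select i (λ j → y i * y j)))))
    (trans (sym (∑-distrib-+ (λ i → sum (λ j → ⟦ does (adj? (complement G) i j) ⟧ * (y i * y j)))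
                             (λ i → sum (λ j → ⟦ does (i Fin.≟ j) ⟧ * (y i * y j)))))
      (sum-cong-≗ λ i → trans
        (sym (∑-distrib-+ (λ j → ⟦ does (adj? (complement G) i j) ⟧ * (y i * y j))
                          (λ j → ⟦ does (i Fin.≟ j) ⟧ * (y i * y j))))
        (sum-cong-≗ λ j → trans
          (sym (*-distribʳ-+ (y i * y j) ⟦ does (adj? (complement G) i j) ⟧ ⟦ does (i Fin.≟ j) ⟧))
          (cong (_* (y i * y j)) (partition (i Fin.≟ j))))))
    where
    partition : ∀ {i j} (i≟j : Dec (i ≡ j)) →
      ⟦ not (does i≟j) ∧ not (edge i j) ⟧ + ⟦ does i≟j ⟧ ≡ ⟦ not (edge i j) ⟧
    partition {i} {j} (yes i≡j) = sym (cong (λ a → ⟦ not a ⟧) (dec-false (adj? G i j) (irrefl G i≡j)))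
    partition {i} {j} (no _)    = +-identityʳ ⟦ not (edge i j) ⟧

0≤sum-ones : ∀ n → 0ℚ ≤ sum-ones n
0≤sum-ones n = 0≤sum {n} {λ _ → 1ℚ} (λ _ → 0≤⟦⟧ true)

square≤norm : ∀ {n} (x : Vector ℚ n) {δ} → 0ℚ ≤ δ → ∀ k → δ ≤ ∣ x k ∣ →
  δ * δ ≤ sum (λ i → x i * x i)
square≤norm x {δ} 0≤δ k δ≤∣xₖ∣ = ≤-trans
  (subst (δ * δ ≤_) (∣p∣*∣p∣≡p*p (x k)) (*-mono 0≤δ (0≤∣p∣ (x k)) δ≤∣xₖ∣ δ≤∣xₖ∣))
  (term≤sum {f = λ i → x i * x i} (λ i → 0≤p*p (x i)) k)

-- Pair the residual with x. From (∣xᵢ∣ - δ)² ≥ 0 follows 2δ∣xᵢ∣η ≤ η(xᵢ² + δ²); summing over i and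
-- using δ² ≤ ∥x∥² bounds the error by (1 + n)η∥x∥² = 2δθ∥x∥².
approximate-rayleigh : ∀ {n} (m : Fin n → Vector ℚ n) (x : Vector ℚ n) {l θ δ η} → 0ℚ < δ → 0ℚ ≤ η →
  ∀ k → δ ≤ ∣ x k ∣ → (1ℚ + sum-ones n) * η ≡ (δ + δ) * θ →
  (∀ i → ∣ l * x i - sum (λ j → m i j * x j) ∣ ≤ η) →
  l * sum (λ i → x i * x i) ≤ quadratic-form m x + θ * sum (λ i → x i * x i)
approximate-rayleigh {n} m x {l} {θ} {δ} {η} 0<δ 0≤η k δ≤∣xₖ∣ η≡ residual≤η =
  ≤-cancel-* (0<+ 0<δ 0≤δ)
    (≤-by (0≤+ (p≤q⇒0≤q-p total) (0≤* (0≤* 0≤η (0≤sum-ones n)) (p≤q⇒0≤q-p (square≤norm x 0≤δ k δ≤∣xₖ∣))))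
      (trans (expand A P θ δ) (trans (cong (λ s → (δ + δ) * A + s * P) (sym η≡))
        (collect A P l δ η (sum-ones n)))))
  where
  P = sum (λ i → x i * x i)
  A = quadratic-form m x
  0≤δ = <⇒≤ 0<δ
  residual : Vector ℚ n
  residual i = l * x i - sum (λ j → m i j * x j)

  expand : ∀ A P θ δ → (δ + δ) * (A + θ * P) ≡ (δ + δ) * A + (δ + δ) * θ * P
  expand = solve-∀ ℚ-ring
  collect : ∀ A P l δ η N → (δ + δ) * A + (1ℚ + N) * η * P ≡ (δ + δ) * (l * P)
    + (η * P + η * (δ * δ) * N - (δ + δ) * (l * P + - 1ℚ * A) + η * N * (P - δ * δ))
  collect = solve-∀ ℚ-ring

  term : ∀ i → (δ + δ) * (x i * residual i) ≤ η * (x i * x i) + η * (δ * δ) * 1ℚ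
  term i = ≤-trans
    (*-monoˡ-≤-nonNeg (δ + δ) {{nonNegative (0≤+ 0≤δ 0≤δ)}}
      (≤-trans (p≤∣p∣ (x i * residual i)) (subst (_≤ ∣ x i ∣ * η) (sym (∣p*q∣≡∣p∣*∣q∣ (x i) (residual i)))
        (*-monoˡ-≤-nonNeg ∣ x i ∣ {{∣-∣-nonNeg (x i)}} (residual≤η i)))))
    (≤-by (0≤* 0≤η (0≤p*p (∣ x i ∣ - δ)))
      (trans (cong (λ s → η * s + η * (δ * δ) * 1ℚ) (sym (∣p∣*∣p∣≡p*p (x i)))) (square η δ ∣ x i ∣)))
    where
    square : ∀ η δ a → η * (a * a) + η * (δ * δ) * 1ℚ ≡ (δ + δ) * (a * η) + η * ((a - δ) * (a - δ))
    square = solve-∀ ℚ-ring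

  Σx*residual : sum (λ i → x i * residual i) ≡ l * P + - 1ℚ * A
  Σx*residual = trans (sum-cong-≗ (λ i → trans (distribute (x i) l (sum (λ j → m i j * x j)))
      (cong (λ s → l * (x i * x i) + - 1ℚ * s) (trans (*-distribˡ-sum (x i) (λ j → m i j * x j))
        (sum-cong-≗ (λ j → swap (x i) (m i j) (x j)))))))
    (sum-linear l (- 1ℚ) (λ i → x i * x i) (λ i → sum (λ j → m i j * (x i * x j))))
    where
    distribute : ∀ x l s → x * (l * x - s) ≡ l * (x * x) + - 1ℚ * (x * s)
    distribute = solve-∀ ℚ-ring
    swap : ∀ x a y → x * (a * y) ≡ a * (x * y)
    swap = solve-∀ ℚ-ring

  total : (δ + δ) * (l * P + - 1ℚ * A) ≤ η * P + η * (δ * δ) * sum-ones n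
  total = subst₂ _≤_
    (trans (sym (*-distribˡ-sum (δ + δ) (λ i → x i * residual i))) (cong ((δ + δ) *_) Σx*residual))
    (sum-linear η (η * (δ * δ)) (λ i → x i * x i) (λ _ → 1ℚ))
    (sum-mono-≤ term)

-- Passage to the real numbers

Eventually : (ℕ → Set) → Set
Eventually P = ∃[ N ] (∀ k → N ℕ.≤ k → P k)

infixr 4 _∧ᵉ_
_∧ᵉ_ : ∀ {P Q : ℕ → Set} → Eventually P → Eventually Q → Eventually (λ k → P k × Q k)
(M , p) ∧ᵉ (N , q) = M ℕ.⊔ N , λ k M⊔N≤k →
  p k (ℕ.≤-trans (ℕ.m≤m⊔n M N) M⊔N≤k) , q k (ℕ.≤-trans (ℕ.m≤n⊔m M N) M⊔N≤k)

eventually-∀ : ∀ {n} {P : Fin n → ℕ → Set} → (∀ i → Eventually (P i)) → Eventually (λ k → ∀ i → P i k)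
eventually-∀ {zero}  _ = 0 , λ _ _ ()
eventually-∀ {suc n} p with p zero ∧ᵉ eventually-∀ (p ∘ suc)
... | N , q = N , λ k N≤k → λ { zero → proj₁ (q k N≤k) ; (suc i) → proj₂ (q k N≤k) i }

¬¬-eventually : ∀ {P : ℕ → Set} → Eventually P → ¬ (∀ k → ¬ P k)
¬¬-eventually (N , p) ¬P = ¬P N (p N ℕ.≤-refl)

0<½ : ∀ {p} → 0ℚ < p → 0ℚ < ½ * p
0<½ = 0<* (positive⁻¹ ½)

½+½ : ∀ p → ½ * p + ½ * p ≡ p
½+½ p = trans (sym (*-distribʳ-+ p ½ ½)) (*-identityˡ p)

∣p∣≤∣p-q∣+∣q∣ : ∀ p q → ∣ p ∣ ≤ ∣ p - q ∣ + ∣ q ∣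
∣p∣≤∣p-q∣+∣q∣ p q = subst (λ r → ∣ r ∣ ≤ ∣ p - q ∣ + ∣ q ∣) (identity p q) (∣p+q∣≤∣p∣+∣q∣ (p - q) q)
  where
  identity : ∀ p q → p - q + q ≡ p
  identity = solve-∀ ℚ-ring

∣p-q∣≡∣q-p∣ : ∀ p q → ∣ p - q ∣ ≡ ∣ q - p ∣
∣p-q∣≡∣q-p∣ p q = trans (sym (∣-p∣≡∣p∣ (p - q))) (cong ∣_∣ (identity p q))
  where
  identity : ∀ p q → - (p - q) ≡ q - p
  identity = solve-∀ ℚ-ring

AwayFrom0 : ℝ → Set
AwayFrom0 x = ∃[ δ ] 0ℚ < δ × Eventually (λ k → δ ≤ ∣ seq x k ∣)

-- Past an index N the terms move by less than ε/4. Comparing the N-th term with ε/2 decides whether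
-- all later ones stay below ε or stay at least ε/4 in absolute value.
¬away⇒≃0 : ∀ x → ¬ AwayFrom0 x → x ≃ᴿ 0ᴿ
¬away⇒≃0 x ¬away ε 0<ε with cauchy x (½ * (½ * ε)) (0<½ (0<½ 0<ε))
... | N , close with ∣ seq x N ∣ <? ½ * ε
... | yes small = N , λ k N≤k → subst (λ p → ∣ p ∣ < ε) (sym (+-identityʳ (seq x k))) (begin-strict
  ∣ seq x k ∣                             ≤⟨ ∣p∣≤∣p-q∣+∣q∣ (seq x k) (seq x N) ⟩
  ∣ seq x k - seq x N ∣ + ∣ seq x N ∣     <⟨ +-mono-< (close k N N≤k ℕ.≤-refl) small ⟩
  ½ * (½ * ε) + ½ * ε                     ≤⟨ +-monoˡ-≤ (½ * ε)
    (≤-by {½ * (½ * ε)} {½ * ε} (<⇒≤ (0<½ (0<½ 0<ε))) (sym (½+½ (½ * ε)))) ⟩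
  ½ * ε + ½ * ε                           ≡⟨ ½+½ ε ⟩
  ε                                       ∎)
  where open ≤-Reasoning
... | no large = contradiction
  (½ * (½ * ε) , 0<½ (0<½ 0<ε) , N , λ k N≤k → bound k N≤k) ¬away
  where
  bound : ∀ k → N ℕ.≤ k → ½ * (½ * ε) ≤ ∣ seq x k ∣
  bound k N≤k = ≤-by {½ * (½ * ε)} {∣ seq x k ∣} (p≤q⇒0≤q-p (begin
    ½ * ε                                 ≤⟨ ≮⇒≥ large ⟩
    ∣ seq x N ∣                           ≤⟨ ∣p∣≤∣p-q∣+∣q∣ (seq x N) (seq x k) ⟩
    ∣ seq x N - seq x k ∣ + ∣ seq x k ∣   ≤⟨ +-monoˡ-≤ ∣ seq x k ∣ (<⇒≤ (close N k ℕ.≤-refl N≤k)) ⟩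
    ½ * (½ * ε) + ∣ seq x k ∣             ∎))
    (trans (identity (½ * (½ * ε)) ∣ seq x k ∣)
      (cong (λ h → ½ * (½ * ε) + (½ * (½ * ε) + ∣ seq x k ∣ - h)) (½+½ (½ * ε))))
    where
    open ≤-Reasoning
    identity : ∀ q a → a ≡ q + (q + a - (q + q))
    identity = solve-∀ ℚ-ring

-- Whether x stays below c + ε can be decided up to ε at a single index, so the
-- bound may be proved by contradiction; a nonzero eigenvector may then be
-- assumed to have an entry bounded away from 0.
≤ᴿ-fromℚ : ∀ x c → (∀ δ → 0ℚ < δ → ¬ Eventually (λ k → c + δ ≤ seq x k)) → x ≤ᴿ fromℚ c
≤ᴿ-fromℚ x c ¬exceeds ε 0<ε with cauchy x (½ * (½ * ε)) (0<½ (0<½ 0<ε))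
... | N , close with seq x N <? c + ½ * ε
... | yes below = N , λ k N≤k → <-by (0<+ (p<q⇒0<q-p below)
    (0≤+ (p≤q⇒0≤q-p (<⇒≤ (≤-<-trans (p≤∣p∣ (seq x k - seq x N)) (close k N N≤k ℕ.≤-refl)))) 0≤q))
    (trans (cong (λ p → c + p) (sym (trans (cong (λ h → ½ * ε + h) (½+½ (½ * ε))) (½+½ ε))))
      (identity c (½ * ε) q (seq x N) (seq x k)))
  where
  q = ½ * (½ * ε)
  0≤q = <⇒≤ (0<½ (0<½ 0<ε))
  identity : ∀ c h q s t → c + (h + (q + q)) ≡ t + (c + h - s + (q - (t - s) + q))
  identity = solve-∀ ℚ-ring
... | no above = contradiction (N , λ k N≤k → ≤-by (0≤+ (p≤q⇒0≤q-p (≮⇒≥ above))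
        (p≤q⇒0≤q-p (<⇒≤ (≤-<-trans (p≤∣p∣ (seq x N - seq x k)) (close N k ℕ.≤-refl N≤k)))))
      (trans (identity c q (seq x N) (seq x k))
        (cong (λ h → c + q + (seq x N - (c + h) + (q - (seq x N - seq x k)))) (½+½ (½ * ε)))))
    (¬exceeds q (0<½ (0<½ 0<ε)))
  where
  q = ½ * (½ * ε)
  identity : ∀ c q s t → t ≡ c + q + (s - (c + (q + q)) + (q - (s - t)))
  identity = solve-∀ ℚ-ring

-- Eigenvalue equations term by term

seq-sum : ∀ {n} (f : Vector ℝ n) k → seq (Defs.sum f) k ≡ sum (λ i → seq (f i) k)
seq-sum {zero}  f k = refl
seq-sum {suc n} f k = cong (λ s → seq (f zero) k + s) (seq-sum (f ∘ suc) k)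

seq-adjacencyMatrix : ∀ {n} (G : SimpleGraph n) i j k →
  seq (adjacencyMatrix G i j) k ≡ ⟦ edge G i j ⟧
seq-adjacencyMatrix G i j k with does (adj? G i j)
... | true  = refl
... | false = refl

seq-*ᵛ : ∀ {n} (G : SimpleGraph n) v i k →
  seq ((adjacencyMatrix G *ᵛ v) i) k ≡ sum (λ j → ⟦ edge G i j ⟧ * seq (v j) k)
seq-*ᵛ G v i k = trans (seq-sum (λ j → adjacencyMatrix G i j *ᴿ v j) k)
  (sum-cong-≗ (λ j → cong (_* seq (v j) k) (seq-adjacencyMatrix G i j k)))

divide : ∀ p q → 0ℚ < p → 0ℚ < q → ∃[ r ] 0ℚ < r × p * r ≡ q
divide p q 0<p 0<q = proj₁ excess , 0<p*q⇒0<q {p} {proj₁ excess} (<⇒≤ 0<p) (subst (0ℚ <_) (sym p*r≡q) 0<q) , p*r≡q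
  where
  excess = divide-excess 0ℚ q 0<p
  p*r≡q : p * proj₁ excess ≡ q
  p*r≡q = trans (identity p (proj₁ excess)) (proj₂ excess)
    where
    identity : ∀ p r → p * r ≡ (0ℚ + r) * p
    identity = solve-∀ ℚ-ring

map-eventually : ∀ {P Q : ℕ → Set} → (∀ k → P k → Q k) → Eventually P → Eventually Q
map-eventually P⇒Q (N , p) = N , λ k N≤k → P⇒Q k (p k N≤k)

module _ {n} (G : SimpleGraph n) (μ : ℝ) (v : Vector ℝ n)
  (Av≃μv : ∀ i → (adjacencyMatrix G *ᵛ v) i ≃ᴿ μ *ᴿ v i) where

  private
    x : ℕ → Vector ℚ n
    x k i = seq (v i) k

    residual≡ : ∀ k i → ∣ seq ((adjacencyMatrix G *ᵛ v) i) k - seq μ k * seq (v i) k ∣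
      ≡ ∣ seq μ k * seq (v i) k - sum (λ j → ⟦ edge G i j ⟧ * seq (v j) k) ∣
    residual≡ k i = subst
      (λ s → ∣ seq ((adjacencyMatrix G *ᵛ v) i) k - seq μ k * seq (v i) k ∣ ≡ ∣ seq μ k * seq (v i) k - s ∣)
      (seq-*ᵛ G v i k)
      (∣p-q∣≡∣q-p∣ (seq ((adjacencyMatrix G *ᵛ v) i) k) (seq μ k * seq (v i) k))

    RayleighBound : ℚ → ℕ → Set
    RayleighBound θ k = 0ℚ < sum (λ i → x k i * x k i) ×
      seq μ k * sum (λ i → x k i * x k i) ≤
        quadratic-form (λ i j → ⟦ edge G i j ⟧) (x k) + θ * sum (λ i → x k i * x k i)

    residual⇒rayleigh : ∀ {δ θ η} i → 0ℚ < δ → 0ℚ < η → (1ℚ + sum-ones n) * η ≡ (δ + δ) * θ → ∀ k →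
      δ ≤ ∣ x k i ∣ × (∀ j → ∣ seq ((adjacencyMatrix G *ᵛ v) j) k - seq μ k * x k j ∣ < η) →
      RayleighBound θ k
    residual⇒rayleigh {δ} {θ} {η} i 0<δ 0<η η≡ k (δ≤∣vᵢ∣ , residual<η) =
      <-≤-trans {0ℚ} {δ * δ} {sum (λ i → x k i * x k i)} (0<* {δ} {δ} 0<δ 0<δ)
        (square≤norm (x k) {δ} (<⇒≤ 0<δ) i δ≤∣vᵢ∣) ,
      approximate-rayleigh (λ i j → ⟦ edge G i j ⟧) (x k) {seq μ k} {θ} {δ} {η} 0<δ (<⇒≤ 0<η) i δ≤∣vᵢ∣
        η≡ (λ j → subst (_≤ η) (residual≡ k j) (<⇒≤ (residual<η j)))

  -- The accuracy η is chosen to meet the hypothesis of `approximate-rayleigh`; the finitely many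
  -- coordinates of the eigenvalue equation reach it at a common index.
  eventually-rayleigh : ∀ i → AwayFrom0 (v i) → ∀ {θ} → 0ℚ < θ → Eventually (RayleighBound θ)
  eventually-rayleigh i (δ , 0<δ , vᵢ-away) {θ} 0<θ = from-residual
    (divide (1ℚ + sum-ones n) ((δ + δ) * θ) (0<+ (positive⁻¹ 1ℚ) (0≤sum-ones n))
      (0<* {δ + δ} {θ} (0<+ 0<δ (<⇒≤ 0<δ)) 0<θ))
    where
    from-residual : ∃[ η ] 0ℚ < η × (1ℚ + sum-ones n) * η ≡ (δ + δ) * θ → Eventually (RayleighBound θ)
    from-residual (η , 0<η , η≡) = map-eventually (residual⇒rayleigh {δ} {θ} {η} i 0<δ 0<η η≡)
      (vᵢ-away ∧ᵉ eventually-∀ (λ j → Av≃μv j η 0<η))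

-- The sum exceeds the bound by 4θ and the two approximations cost only θ each, so a margin of 2θ,
-- times PQ, remains.
rayleigh-contradiction : ∀ {P Q l l̄ θ α ᾱ} h → 0ℚ < θ → 0ℚ < P → 0ℚ < Q →
  h + h + h + h - 1ℚ + (θ + θ + (θ + θ)) ≤ l + l̄ →
  l * P ≤ α + θ * P → l̄ * Q ≤ ᾱ + θ * Q →
  ¬ Q * α + P * (ᾱ + Q) ≤ (h + h + h + h) * (P * Q)
rayleigh-contradiction {P} {Q} {l} {l̄} {θ} {α} {ᾱ} h 0<θ 0<P 0<Q exceeds rayleigh rayleigh′ forms =
  contradiction refl (<⇒≢ (subst (0ℚ <_) (identity P Q l l̄ h θ α ᾱ)
    (0<+ (0<* (0<* 0<P 0<Q) (0<+ 0<θ (<⇒≤ 0<θ)))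
      (0≤+ (0≤* (<⇒≤ (0<* 0<P 0<Q)) (p≤q⇒0≤q-p exceeds))
        (0≤+ (0≤* (<⇒≤ 0<Q) (p≤q⇒0≤q-p rayleigh))
          (0≤+ (0≤* (<⇒≤ 0<P) (p≤q⇒0≤q-p rayleigh′)) (p≤q⇒0≤q-p forms)))))))
  where
  identity : ∀ P Q l l̄ h θ α ᾱ →
    P * Q * (θ + θ) + (P * Q * (l + l̄ - (h + h + h + h - 1ℚ + (θ + θ + (θ + θ))))
    + (Q * (α + θ * P - l * P) + (P * (ᾱ + θ * Q - l̄ * Q)
    + ((h + h + h + h) * (P * Q) - (Q * α + P * (ᾱ + Q)))))) ≡ 0ℚ
  identity = solve-∀ ℚ-ring

-- Passing to absolute values makes both vectors nonnegative, as `quadratic-forms-bound` requires.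
graph-forms-bound : ∀ {n} (G : SimpleGraph n) (x y : Vector ℚ n) {h} → sum-ones n ≡ h + h + h →
  0ℚ < sum (λ i → x i * x i) → 0ℚ < sum (λ i → y i * y i) →
  sum (λ i → y i * y i) * quadratic-form (λ i j → ⟦ edge G i j ⟧) x
  + sum (λ i → x i * x i) * (quadratic-form (λ i j → ⟦ edge (complement G) i j ⟧) y + sum (λ i → y i * y i))
  ≤ (h + h + h + h) * (sum (λ i → x i * x i) * sum (λ i → y i * y i))
graph-forms-bound {n} G x y {h} n≡3h 0<P 0<Q = begin
  Q * α x + P * (quadratic-form (λ i j → ⟦ edge (complement G) i j ⟧) y + Q)
    ≡⟨ cong (λ s → Q * α x + P * s) (complement-form G y) ⟩
  Q * α x + P * ᾱ y
    ≤⟨ +-monoˡ-≤ (P * ᾱ y) {Q * α x} {Q * α ∣x∣}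
         (*-monoˡ-≤-nonNeg Q {{nonNegative (<⇒≤ 0<Q)}} {α x} {α ∣x∣} α-mono) ⟩
  Q * α ∣x∣ + P * ᾱ y
    ≤⟨ +-monoʳ-≤ (Q * α ∣x∣) {P * ᾱ y} {P * ᾱ ∣y∣}
         (*-monoˡ-≤-nonNeg P {{nonNegative (<⇒≤ 0<P)}} {ᾱ y} {ᾱ ∣y∣} ᾱ-mono) ⟩
  Q * α ∣x∣ + P * ᾱ ∣y∣
    ≡⟨ cong₂ (λ P Q → Q * α ∣x∣ + P * ᾱ ∣y∣) (norm-∣∣ x) (norm-∣∣ y) ⟨
  sum (λ i → ∣y∣ i * ∣y∣ i) * α ∣x∣ + sum (λ i → ∣x∣ i * ∣x∣ i) * ᾱ ∣y∣
    ≤⟨ bound ⟩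
  (h + h + h + h) * (sum (λ i → ∣x∣ i * ∣x∣ i) * sum (λ i → ∣y∣ i * ∣y∣ i))
    ≡⟨ cong₂ (λ P Q → (h + h + h + h) * (P * Q)) (norm-∣∣ x) (norm-∣∣ y) ⟩
  (h + h + h + h) * (P * Q) ∎
  where
  open ≤-Reasoning
  P = sum (λ i → x i * x i)
  Q = sum (λ i → y i * y i)
  ∣x∣ ∣y∣ : Vector ℚ n
  ∣x∣ i = ∣ x i ∣
  ∣y∣ i = ∣ y i ∣
  α ᾱ : Vector ℚ n → ℚ
  α = quadratic-form (λ i j → ⟦ edge G i j ⟧)
  ᾱ = quadratic-form (λ i j → ⟦ not (edge G i j) ⟧)
  α-mono : α x ≤ α ∣x∣
  α-mono = quadratic-form-∣∣ (λ i j → ⟦ edge G i j ⟧) (λ i j → 0≤⟦⟧ (edge G i j)) x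
  ᾱ-mono : ᾱ y ≤ ᾱ ∣y∣
  ᾱ-mono = quadratic-form-∣∣ (λ i j → ⟦ not (edge G i j) ⟧) (λ i j → 0≤⟦⟧ (not (edge G i j))) y
  norm-∣∣ : ∀ (u : Vector ℚ n) → sum (λ i → ∣ u i ∣ * ∣ u i ∣) ≡ sum (λ i → u i * u i)
  norm-∣∣ u = sum-cong-≗ (λ i → ∣p∣*∣p∣≡p*p (u i))
  bound : sum (λ i → ∣y∣ i * ∣y∣ i) * α ∣x∣ + sum (λ i → ∣x∣ i * ∣x∣ i) * ᾱ ∣y∣
    ≤ (h + h + h + h) * (sum (λ i → ∣x∣ i * ∣x∣ i) * sum (λ i → ∣y∣ i * ∣y∣ i))
  bound = quadratic-forms-bound (edge G) (edge-sym G) {∣x∣} {∣y∣} (λ i → 0≤∣p∣ (x i)) (λ i → 0≤∣p∣ (y i)) {h} n≡3h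
    (subst (0ℚ <_) (sym (norm-∣∣ x)) 0<P) (subst (0ℚ <_) (sym (norm-∣∣ y)) 0<Q)

-- Once the sum is assumed to exceed the bound by δ, the goal is absurdity, so coordinates of v and
-- w away from 0 may be assumed. With θ = δ/4 all estimates hold at one index, where only rational
-- numbers remain.
eigenvalue-sum-bound : ∀ {n} (G : SimpleGraph n) {h μ μ̄} → sum-ones n ≡ h + h + h →
  IsEigenvalue (adjacencyMatrix G) μ → IsEigenvalue (adjacencyMatrix (complement G)) μ̄ →
  μ +ᴿ μ̄ ≤ᴿ fromℚ (h + h + h + h - 1ℚ)
eigenvalue-sum-bound {n} G {h} {μ} {μ̄} n≡3h (v , v≄0 , Gv≃μv) (w , w≄0 , Ḡw≃μ̄w) =
  ≤ᴿ-fromℚ (μ +ᴿ μ̄) (h + h + h + h - 1ℚ) λ δ 0<δ exceeds →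
    v≄0 λ i → ¬away⇒≃0 (v i) λ vᵢ#0 → w≄0 λ j → ¬away⇒≃0 (w j) λ wⱼ#0 →
    ¬¬-eventually
      (exceeds ∧ᵉ eventually-rayleigh G μ v Gv≃μv i vᵢ#0 (0<½ (0<½ 0<δ))
               ∧ᵉ eventually-rayleigh (complement G) μ̄ w Ḡw≃μ̄w j wⱼ#0 (0<½ (0<½ 0<δ)))
      λ k (c+δ≤ , (0<P , Gv) , (0<Q , Ḡw)) →
        rayleigh-contradiction {norm v k} {norm w k} {seq μ k} {seq μ̄ k} {½ * (½ * δ)}
          {quadratic-form (λ i j → ⟦ edge G i j ⟧) (λ i → seq (v i) k)}
          {quadratic-form (λ i j → ⟦ edge (complement G) i j ⟧) (λ i → seq (w i) k)}
          h (0<½ (0<½ 0<δ)) 0<P 0<Q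
          (subst (λ δ → h + h + h + h - 1ℚ + δ ≤ seq μ k + seq μ̄ k) (sym (quarters δ)) c+δ≤) Gv Ḡw
          (graph-forms-bound G (λ i → seq (v i) k) (λ i → seq (w i) k) {h} n≡3h 0<P 0<Q)
  where
  norm : Vector ℝ n → ℕ → ℚ
  norm u k = sum (λ i → seq (u i) k * seq (u i) k)
  quarters : ∀ δ → ½ * (½ * δ) + ½ * (½ * δ) + (½ * (½ * δ) + ½ * (½ * δ)) ≡ δ
  quarters δ = trans (cong₂ _+_ (½+½ (½ * δ)) (½+½ (½ * δ))) (½+½ δ)

theorem1 : (n : ℕ) (G : SimpleGraph n) (λ₁ λ̄₁ : ℝ) →
    Isλ₁ G λ₁ → Isλ₁ (complement G) λ̄₁ →
    λ₁ +ᴿ λ̄₁ ≤ᴿ fromℚ ((+ 4 / 3) * (+ n / 1) - 1ℚ)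
theorem1 n G λ₁ λ̄₁ (eigenvalue , _) (eigenvalue′ , _) =
  subst (λ c → λ₁ +ᴿ λ̄₁ ≤ᴿ fromℚ (c - 1ℚ)) 4h≡
    (eigenvalue-sum-bound G {⅓ * (+ n / 1)} {λ₁} {λ̄₁} n≡3h eigenvalue eigenvalue′)
  where
  ⅓ = + 1 / 3
  4h≡ : ⅓ * (+ n / 1) + ⅓ * (+ n / 1) + ⅓ * (+ n / 1) + ⅓ * (+ n / 1) ≡ (+ 4 / 3) * (+ n / 1)
  4h≡ = trans (identity ⅓ (+ n / 1)) (cong (_* (+ n / 1)) 4/3≡)
    where
    4/3≡ : ⅓ + ⅓ + ⅓ + ⅓ ≡ + 4 / 3
    4/3≡ = refl
    identity : ∀ t p → t * p + t * p + t * p + t * p ≡ (t + t + t + t) * p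
    identity = solve-∀ ℚ-ring
  n≡3h : sum-ones n ≡ ⅓ * (+ n / 1) + ⅓ * (+ n / 1) + ⅓ * (+ n / 1)
  n≡3h = trans (sum-ones≡n/1 n) (trans (sym (*-identityˡ (+ n / 1)))
    (trans (cong (_* (+ n / 1)) 1≡) (sym (identity ⅓ (+ n / 1)))))
    where
    1≡ : 1ℚ ≡ ⅓ + ⅓ + ⅓
    1≡ = refl
    identity : ∀ t p → t * p + t * p + t * p ≡ (t + t + t) * p
    identity = solve-∀ ℚ-ring
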